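{- For every non-monotone pattern $\sigma\in S_m\setminus\{(1\,2\,\dots\,m),(m\,\dots\,2\,1)\}$, $$\rho_{\sigma}\leq 1-\frac{1}{m!}+O\left(\frac{1}{m^2\, m!}\right),$$ where the $O$-term refers to $m\to\infty$ and is uniform in $\sigma$: there are constants $C>0$ and $m_0$ such that for all $m\ge m_0$ and all non-monotone $\sigma\in S_m$, $\rho_\sigma\le 1-\frac{1}{m!}+\frac{C}{m^2\,m!}$.
   Context: $S_n$ denotes the set of permutations of $\{1,\dots,n\}$, written $\pi=(\pi_1,\dots,\pi_n)$. For a sequence $(x_1,\dots,x_k)$ of distinct integers, its standardization $\mathrm{st}(x_1,\dots,x_k)\in S_k$ is obtained by replacing each entry by its rank among $x_1,\dots,x_k$. A permutation $\pi\in S_n$ contains $\sigma\in S_m$ as a consecutive pattern if $\mathrm{st}(\pi_{i+1},\dots,\pi_{i+m})=\sigma$ for some $0\le i\le n-m$; otherwise $\pi$ is $\sigma$-avoiding. Let $\alpha_n(\sigma)$ be the number of $\sigma$-avoiding permutations in $S_n$, and $\rho_\sigma=\lim_{n\to\infty}(\alpha_n(\sigma)/n!)^{1/n}$ (this limit is known to exist). The monotone patterns of length $m$ are $(1\,2\,\dots\,m)$ and $(m\,\dots\,2\,1)$. -}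

module Defs where

open import Data.Nat as ℕ using (ℕ; zero; suc; _<?_; _∸_)
open import Data.Nat using (_!)
open import Data.Integer using (+_)
open import Data.Rational using (ℚ; _/_; _+_; _-_; _*_; 1ℚ; 0ℚ)
open import Data.List using (List; []; _∷_; length; filter; map; take; drop; upTo; concatMap; reverse)
open import Data.List.Relation.Unary.Any using (Any; any?)
open import Data.List.Properties using (≡-dec)
open import Relation.Binary.PropositionalEquality using (_≡_)
open import Relation.Nullary using (Dec; ¬?)

-- A permutation of {1,…,n} is represented by its one-line notation (π₁,…,πₙ).

insertions : ℕ → List ℕ → List (List ℕ)
insertions x []       = (x ∷ []) ∷ []
insertions x (y ∷ ys) = (x ∷ y ∷ ys) ∷ map (y ∷_) (insertions x ys)

S : ℕ → List (List ℕ)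
S zero    = [] ∷ []
S (suc n) = concatMap (insertions (suc n)) (S n)

-- rank of x among the entries of xs (1-based, for distinct entries)
rank : List ℕ → ℕ → ℕ
rank xs x = suc (length (filter (_<? x) xs))

st : List ℕ → List ℕ
st xs = map (rank xs) xs

-- π contains σ as a consecutive pattern: st(π_{i+1},…,π_{i+m}) = σ for some 0 ≤ i ≤ n-m
-- (when m > n the single window is too short, so it never matches)
Contains : List ℕ → List ℕ → Set
Contains σ π = Any (λ i → st (take (length σ) (drop i π)) ≡ σ)
                   (upTo (suc (length π ∸ length σ)))

contains? : (σ π : List ℕ) → Dec (Contains σ π)
contains? σ π = any? (λ i → ≡-dec ℕ._≟_ (st (take (length σ) (drop i π))) σ)
                     (upTo (suc (length π ∸ length σ)))

α : ℕ → List ℕ → ℕ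
α n σ = length (filter (λ π → ¬? (contains? σ π)) (S n))

increasing : ℕ → List ℕ
increasing m = map suc (upTo m)

decreasing : ℕ → List ℕ
decreasing m = reverse (increasing m)

ℕ→ℚ : ℕ → ℚ
ℕ→ℚ n = (+ n) / 1

-- 1/k as a rational, with the convention 1/0 = 0 (only used for k = m² · m!, m ≥ 1 relevant)
inv : ℕ → ℚ
inv zero    = 0ℚ
inv (suc k) = (+ 1) / suc k

pow : ℚ → ℕ → ℚ
pow q zero    = 1ℚ
pow q (suc n) = q * pow q n

bound : ℚ → ℕ → ℚ
bound C m = (1ℚ - inv (m !)) + C * inv (m ℕ.* m ℕ.* (m !))

-- ρ_σ ≤ r, where ρ_σ = lim (α_n(σ)/n!)^{1/n}; since the limit exists, this is
-- equivalent to: for every rational ε > 0, eventually α_n(σ)/n! ≤ (r + ε)^n.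
ρ≤ : List ℕ → ℚ → Set
ρ≤ σ r = ∀ (ε : ℚ) → 0ℚ Data.Rational.< ε →
           Data.Product.Σ ℕ (λ N → ∀ (n : ℕ) → N ℕ.≤ n →
             ℕ→ℚ (α n σ) Data.Rational.≤ ℕ→ℚ (n !) * pow (r + ε) n)
  where import Data.Product

{-# OPTIONS --safe #-}
module Submission where

-- Put a n = α n σ / n !.  Among the permutations of n whose first n - 1 entries avoid σ, those whose last window
-- matches σ are lost.  Patterns of disjoint blocks are independent, so a last match preceded by an avoiding block of
-- length n - m has probability a (n - m) / m !; discarding those with an earlier match shifted by k gives
--   a n + a (n - m) / m ! ≤ a (n - 1) + Σ_{1 ≤ k < m} a (n - m - k) |D k| / (m + k) !,
-- where D k is the set of permutations of m + k whose first and last m entries both have pattern σ.  If D 1 is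
-- inhabited then σ is monotone, and |D k| ≤ (2 k) ! / (k !)² ≤ 4 ^ k, so the sum over k ≥ 2 is dominated by its
-- first term, of order 1 / (m² m !).  As a is nonincreasing, a (n - m) may be replaced by a (n - 1), and
-- a n ≤ 2 r ^ n with r = 1 - 1 / m ! + 64 / (m² m !) follows by induction, because r ^ (2 m) ≥ 1 / 2.

open import Defs
open import Data.Empty using (⊥-elim)
import Data.Integer as ℤ
import Data.Integer.Properties as ℤₚ
open import Data.List using (List; []; _∷_; _++_; [_]; length; map; filter; take; drop; upTo; downFrom;
  applyUpTo; concat; concatMap; reverse; head; cartesianProduct)
open import Data.List.Membership.Propositional using (_∈_; _∉_; find; lose)
open import Data.List.Membership.Propositional.Properties
open import Data.List.Properties
open import Data.List.Relation.Binary.Permutation.Propositional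
  using (_↭_; prep; swap; ↭-refl; ↭-trans; ↭-sym; ↭-reflexive; ↭⇒↭ₛ)
open import Data.List.Relation.Binary.Permutation.Propositional.Properties
  using (∈-resp-↭; ↭-length; filter-↭; shift)
import Data.List.Relation.Binary.Permutation.Propositional.Properties as ↭ₚ
open import Data.List.Relation.Binary.Subset.Propositional using (_⊆_)
open import Data.List.Relation.Unary.All using ([]; _∷_)
import Data.List.Relation.Unary.All as All
import Data.List.Relation.Unary.All.Properties as Allₚ
open import Data.List.Relation.Unary.AllPairs using (AllPairs; []; _∷_)
import Data.List.Relation.Unary.AllPairs as AllPairs
import Data.List.Relation.Unary.AllPairs.Properties as AllPairsₚ
open import Data.List.Relation.Unary.Any using (Any; here; there)
import Data.List.Relation.Unary.Any as Any
open import Data.List.Relation.Unary.Linked using (Linked; [-]; _∷_)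
open import Data.List.Relation.Unary.Linked.Properties using (Linked⇒AllPairs)
open import Data.List.Relation.Unary.Unique.Propositional using (Unique)
import Data.List.Relation.Unary.Unique.Propositional.Properties as Uniqueₚ
open import Data.Maybe using (fromMaybe)
open import Data.Nat
open import Data.Nat.Induction using (<-rec)
open import Data.Nat.ListAction using (sum)
open import Data.Nat.Properties
open import Data.Nat.Solver using (module +-*-Solver)
open import Data.Product using (Σ; ∃; _×_; _,_; -,_; proj₁; proj₂)
open import Data.Rational as ℚ using (ℚ; 0ℚ; 1ℚ)
import Data.Rational.Properties as ℚₚ
import Data.Rational.Solver as ℚ-Solver
open import Data.Rational.Unnormalised as ℚᵘ using (mkℚᵘ; *≡*; *≤*)
import Data.Rational.Unnormalised.Properties as ℚᵘₚ
open import Data.Sum using (_⊎_; inj₁; inj₂)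
open import Data.Unit using (⊤; tt)
open import Function using (_∘_; id)
open import Relation.Binary.Definitions using (Tri; tri<; tri≈; tri>; Transitive)
open import Relation.Binary.PropositionalEquality hiding ([_])
open import Relation.Nullary using (yes; no; ¬_; ¬?)
open import Relation.Nullary.Decidable using (_×-dec_)
open import Relation.Unary using (Decidable)
open +-*-Solver using (solve; _:=_; _:+_; _:*_; con)

-- The overlap terms contain a (n - m - k), which may exceed a (n - 1), so the recurrence does not
-- close on consecutive values. Strong induction bounds a (n - m - k) by 2 r ^ (n - m - k) instead,
-- and since this reaches back at most 2 m steps, passing to r ^ n costs one further factor 2. For n
-- ≤ 2 m the claim is immediate from a n ≤ 1 ≤ 2 r ^ n. The constant 64 is 16 * 2 * 2: the bound 4 ^
-- k at k = 2, the geometric sum with ratio 4 / m ≤ 1 / 2, and the factor for reaching back; the 2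
-- of the induction hypothesis reappears in the conclusion. A nonempty D 1 would add a term of order
-- 1 / (m m !), too large for the claimed error. All of this is carried out in natural numbers, with
-- denominators cleared and subtractions moved to the other side. Rationals enter only at the end,
-- where the factor 2 in front of r ^ n is absorbed by ε.

private variable
  A B : Set

-- Finite counting

Unique-resp-↭ : {xs ys : List A} → xs ↭ ys → Unique xs → Unique ys
Unique-resp-↭ p = Sₚ.Unique-resp-↭ (↭⇒↭ₛ p)
  where import Data.List.Relation.Binary.Permutation.Setoid.Properties (setoid _) as Sₚ

unique-⊆⇒↭-++ : {xs ys : List A} → Unique xs → xs ⊆ ys → ∃ λ zs → ys ↭ xs ++ zs
unique-⊆⇒↭-++ [] _ = -, ↭-refl
unique-⊆⇒↭-++ {xs = x ∷ xs} {ys} (x∉xs ∷ u) sub with ∈-∃++ (sub (here refl))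
... | as , bs , refl = let zs , p = unique-⊆⇒↭-++ u sub′ in zs , ↭-trans (shift x as bs) (prep x p)
  where
  sub′ : xs ⊆ as ++ bs
  sub′ z∈ with ∈-resp-↭ (shift x as bs) (sub (there z∈))
  ... | here refl = ⊥-elim (All.lookup x∉xs z∈ refl)
  ... | there q   = q

unique-⊆⇒length≤ : {xs ys : List A} → Unique xs → xs ⊆ ys → length xs ≤ length ys
unique-⊆⇒length≤ {xs = xs} {ys} u sub with unique-⊆⇒↭-++ u sub
... | zs , p = ≤-trans (length-++-≤ˡ xs) (≤-reflexive (sym (↭-length p)))

unique-⊆⇒↭ : {xs ys : List A} → Unique xs → xs ⊆ ys → length ys ≤ length xs → xs ↭ ys
unique-⊆⇒↭ {xs = xs} {ys} u sub le with unique-⊆⇒↭-++ u sub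
... | [] , p = ↭-sym (↭-trans p (↭-reflexive (++-identityʳ xs)))
... | z ∷ zs , p = ⊥-elim (<-irrefl refl (≤-<-trans le (<-≤-trans
        (subst (length xs <_) (sym (trans (length-++ xs) refl)) (m<m+n (length xs) z<s))
        (≤-reflexive (sym (↭-length p))))))

unique-map⁺ : {xs : List A} (f : A → B) →
  (∀ {x y} → x ∈ xs → y ∈ xs → f x ≡ f y → x ≡ y) → Unique xs → Unique (map f xs)
unique-map⁺ f inj [] = []
unique-map⁺ f inj (x∉ ∷ u) =
  Allₚ.map⁺ (All.tabulate λ y∈ eq → All.lookup x∉ y∈ (inj (here refl) (there y∈) eq))
  ∷ unique-map⁺ f (λ p q → inj (there p) (there q)) u

injection⇒length≤ : {xs : List A} {ys : List B} (f : A → B) → Unique xs →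
  (∀ {x} → x ∈ xs → f x ∈ ys) →
  (∀ {x y} → x ∈ xs → y ∈ xs → f x ≡ f y → x ≡ y) → length xs ≤ length ys
injection⇒length≤ {xs = xs} {ys} f u into inj = subst (_≤ length ys) (length-map f xs)
  (unique-⊆⇒length≤ (unique-map⁺ f inj u) sub)
  where
  sub : map f xs ⊆ ys
  sub p with ∈-map⁻ f p
  ... | x , x∈ , refl = into x∈

length-cartesianProduct : (xs : List A) (ys : List B) →
  length (cartesianProduct xs ys) ≡ length xs * length ys
length-cartesianProduct [] ys = refl
length-cartesianProduct (x ∷ xs) ys = trans (length-++ (map (x ,_) ys))
  (cong₂ _+_ (length-map (x ,_) ys) (length-cartesianProduct xs ys))

length-concat-applyUpTo : (f : ℕ → List A) (n : ℕ) →
  length (concat (applyUpTo f n)) ≡ sum (applyUpTo (length ∘ f) n)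
length-concat-applyUpTo f zero = refl
length-concat-applyUpTo f (suc n) =
  trans (length-++ (f 0)) (cong (length (f 0) +_) (length-concat-applyUpTo (f ∘ suc) n))

filter-partition-≤ : {P Q R : A → Set} (P? : Decidable P) (Q? : Decidable Q) (R? : Decidable R) →
  (∀ {x} → P x → R x) → (∀ {x} → Q x → R x) → (∀ {x} → P x → ¬ Q x) → (xs : List A) →
  length (filter P? xs) + length (filter Q? xs) ≤ length (filter R? xs)
filter-partition-≤ P? Q? R? pr qr pq [] = z≤n
filter-partition-≤ P? Q? R? pr qr pq (x ∷ xs)
  with ih ← filter-partition-≤ P? Q? R? pr qr pq xs | P? x | Q? x | R? x
... | yes p | yes q | _     = ⊥-elim (pq p q)
... | yes p | no _  | yes r = s≤s ih
... | yes p | no _  | no ¬r = ⊥-elim (¬r (pr p))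
... | no _  | yes q | yes r = subst (_≤ suc (length (filter R? xs))) (sym (+-suc _ _)) (s≤s ih)
... | no _  | yes q | no ¬r = ⊥-elim (¬r (qr q))
... | no _  | no _  | yes r = m≤n⇒m≤1+n ih
... | no _  | no _  | no ¬r = ih

map-cong-∈ : {f g : A → B} {xs : List A} → (∀ {x} → x ∈ xs → f x ≡ g x) → map f xs ≡ map g xs
map-cong-∈ eq = map-cong-local (All.tabulate eq)

map-≡⇒≡-∈ : {f g : A → B} (xs : List A) → map f xs ≡ map g xs → ∀ {x} → x ∈ xs → f x ≡ g x
map-≡⇒≡-∈ (x ∷ xs) eq (here refl) = ∷-injectiveˡ eq
map-≡⇒≡-∈ (x ∷ xs) eq (there p) = map-≡⇒≡-∈ xs (∷-injectiveʳ eq) p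

unique-concatMap⁺ : {xs : List A} (f : A → List B) → Unique xs →
  (∀ {x} → x ∈ xs → Unique (f x)) →
  (∀ {x y z} → x ∈ xs → y ∈ xs → z ∈ f x → z ∈ f y → x ≡ y) → Unique (concatMap f xs)
unique-concatMap⁺ f [] uf disj = []
unique-concatMap⁺ {xs = x ∷ xs} f (x∉ ∷ u) uf disj =
  Uniqueₚ.++⁺ (uf (here refl))
    (unique-concatMap⁺ f u (uf ∘ there) (λ p q → disj (there p) (there q)))
    λ (z∈fx , z∈rest) → let y , y∈ , z∈fy = find (∈-concatMap⁻ f {xs = xs} z∈rest) in
      All.lookup x∉ y∈ (disj (here refl) (there y∈) z∈fx z∈fy)

length-concatMap-const : {c : ℕ} (f : A → List B) (xs : List A) →
  (∀ {x} → x ∈ xs → length (f x) ≡ c) → length (concatMap f xs) ≡ length xs * c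
length-concatMap-const f [] eq = refl
length-concatMap-const f (x ∷ xs) eq = trans (length-++ (f x))
  (cong₂ _+_ (eq (here refl)) (length-concatMap-const f xs (eq ∘ there)))

length-filter-cong : {P Q : ℕ → Set} (P? : Decidable P) (Q? : Decidable Q) (g h : A → ℕ) (zs : List A) →
  (∀ {z} → z ∈ zs → (P (g z) → Q (h z)) × (Q (h z) → P (g z))) →
  length (filter P? (map g zs)) ≡ length (filter Q? (map h zs))
length-filter-cong P? Q? g h [] eq = refl
length-filter-cong P? Q? g h (z ∷ zs) eq
  with ih ← length-filter-cong P? Q? g h zs (eq ∘ there) | P? (g z) | Q? (h z)
... | yes _ | yes _ = cong suc ih
... | no _  | no _  = ih
... | yes p | no ¬q = ⊥-elim (¬q (proj₁ (eq (here refl)) p))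
... | no ¬p | yes q = ⊥-elim (¬p (proj₂ (eq (here refl)) q))

-- Permutations as lists

insertions-↭ : ∀ x xs {zs} → zs ∈ insertions x xs → zs ↭ x ∷ xs
insertions-↭ x [] (here refl) = ↭-refl
insertions-↭ x (y ∷ ys) (here refl) = ↭-refl
insertions-↭ x (y ∷ ys) (there p) with ∈-map⁻ (y ∷_) p
... | ws , ws∈ , refl = ↭-trans (prep y (insertions-↭ x ys ws∈)) (swap y x ↭-refl)

∈-insertions⁺ : ∀ x as bs → as ++ x ∷ bs ∈ insertions x (as ++ bs)
∈-insertions⁺ x [] [] = here refl
∈-insertions⁺ x [] (b ∷ bs) = here refl
∈-insertions⁺ x (a ∷ as) bs = there (∈-map⁺ (a ∷_) (∈-insertions⁺ x as bs))

insertions-unique : ∀ x xs → x ∉ xs → Unique (insertions x xs)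
insertions-unique x [] x∉ = [] ∷ []
insertions-unique x (y ∷ ys) x∉ =
  All.tabulate (λ z∈ eq → case-∈ (∈-map⁻ (y ∷_) z∈) eq) ∷
  Uniqueₚ.map⁺ ∷-injectiveʳ (insertions-unique x ys (x∉ ∘ there))
  where
  case-∈ : ∀ {zs} → ∃ (λ ws → ws ∈ insertions x ys × zs ≡ y ∷ ws) → x ∷ y ∷ ys ≢ zs
  case-∈ (_ , _ , refl) eq = x∉ (here (∷-injectiveˡ eq))

-- Deleting `x` undoes every insertion of it, so the insertions into two different permutations are
-- disjoint; `S-unique` rests on this.
filter-insertions : ∀ x xs {zs} → x ∉ xs → zs ∈ insertions x xs → filter (λ y → ¬? (y ≟ x)) zs ≡ xs
filter-insertions x [] x∉ (here refl) = filter-reject (λ y → ¬? (y ≟ x)) (λ f → f refl)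
filter-insertions x (y ∷ ys) x∉ (here refl) = trans
  (filter-reject (λ y → ¬? (y ≟ x)) (λ f → f refl))
  (filter-all (λ y → ¬? (y ≟ x)) (All.tabulate λ { p refl → x∉ p }))
filter-insertions x (y ∷ ys) x∉ (there p) with ∈-map⁻ (y ∷_) p
... | ws , ws∈ , refl = trans (filter-accept (λ y → ¬? (y ≟ x)) (λ { refl → x∉ (here refl) }))
  (cong (y ∷_) (filter-insertions x ys (x∉ ∘ there) ws∈))

length-insertions : ∀ x xs → length (insertions x xs) ≡ suc (length xs)
length-insertions x [] = refl
length-insertions x (y ∷ ys) = cong suc (trans (length-map (y ∷_) (insertions x ys)) (length-insertions x ys))

-- Descending, so that the head is the value that `S` inserts last.
iota : ℕ → List ℕ
iota zero    = []
iota (suc n) = suc n ∷ iota n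

length-iota : ∀ n → length (iota n) ≡ n
length-iota zero = refl
length-iota (suc n) = cong suc (length-iota n)

∈-iota⁻ : ∀ n {x} → x ∈ iota n → 1 ≤ x × x ≤ n
∈-iota⁻ (suc n) (here refl) = s≤s z≤n , ≤-refl
∈-iota⁻ (suc n) (there p) = let a , b = ∈-iota⁻ n p in a , m≤n⇒m≤1+n b

∈-iota⁺ : ∀ n {x} → 1 ≤ x → x ≤ n → x ∈ iota n
∈-iota⁺ zero 1≤x z≤n with () ← 1≤x
∈-iota⁺ (suc n) 1≤x x≤ with m≤n⇒m<n∨m≡n x≤
... | inj₁ (s≤s x≤n) = there (∈-iota⁺ n 1≤x x≤n)
... | inj₂ refl = here refl

iota-unique : ∀ n → Unique (iota n)
iota-unique zero = []
iota-unique (suc n) = All.tabulate (λ { p refl → 1+n≰n (proj₂ (∈-iota⁻ n p)) }) ∷ iota-unique n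

∈S⇒↭iota : ∀ n {π} → π ∈ S n → π ↭ iota n
∈S⇒↭iota zero (here refl) = ↭-refl
∈S⇒↭iota (suc n) π∈ with find (∈-concatMap⁻ (insertions (suc n)) {xs = S n} π∈)
... | τ , τ∈ , π∈i = ↭-trans (insertions-↭ (suc n) τ π∈i) (prep (suc n) (∈S⇒↭iota n τ∈))

↭iota⇒∈S : ∀ n {π} → π ↭ iota n → π ∈ S n
↭iota⇒∈S zero p rewrite ↭ₚ.↭-empty-inv p = here refl
↭iota⇒∈S (suc n) {π} p with ∈-∃++ (∈-resp-↭ (↭-sym p) (here refl))
... | as , bs , refl = ∈-concatMap⁺ (insertions (suc n))
  (lose (↭iota⇒∈S n (↭ₚ.drop-∷ (↭-trans (↭-sym (shift (suc n) as bs)) p)))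
        (∈-insertions⁺ (suc n) as bs))

∈S⇒unique : ∀ n {π} → π ∈ S n → Unique π
∈S⇒unique n π∈ = Unique-resp-↭ (↭-sym (∈S⇒↭iota n π∈)) (iota-unique n)

∈S⇒length : ∀ n {π} → π ∈ S n → length π ≡ n
∈S⇒length n π∈ = trans (↭-length (∈S⇒↭iota n π∈)) (length-iota n)

suc∉ : ∀ n {π} → π ∈ S n → suc n ∉ π
suc∉ n π∈ p = 1+n≰n (proj₂ (∈-iota⁻ n (∈-resp-↭ (∈S⇒↭iota n π∈) p)))

S-unique : ∀ n → Unique (S n)
S-unique zero = [] ∷ []
S-unique (suc n) = unique-concatMap⁺ (insertions (suc n)) (S-unique n)
  (λ {τ} τ∈ → insertions-unique (suc n) τ (suc∉ n τ∈))
  (λ {τ} {τ′} τ∈ τ′∈ z∈ z∈′ → trans (sym (filter-insertions (suc n) τ (suc∉ n τ∈) z∈))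
                                      (filter-insertions (suc n) τ′ (suc∉ n τ′∈) z∈′))

length-S : ∀ n → length (S n) ≡ n !
length-S zero = refl
length-S (suc n) = trans
  (length-concatMap-const (insertions (suc n)) (S n)
    (λ {τ} τ∈ → trans (length-insertions (suc n) τ) (cong suc (∈S⇒length n τ∈))))
  (trans (cong (_* suc n) (length-S n)) (*-comm (n !) (suc n)))

-- Standardization

rank-↭ : ∀ {p q} x → p ↭ q → rank p x ≡ rank q x
rank-↭ x pq = cong suc (↭-length (filter-↭ (_<? x) pq))

-- The entries below `x`, and `x` itself besides, all lie below `y`.
rank-mono-< : ∀ {p x y} → x ∈ p → x < y → rank p x < rank p y
rank-mono-< {p} {x} {y} x∈p x<y = s≤s (≤-trans
  (m<m+n (length (filter (_<? x) p)) (filter-some (_≟ x) (Any.map sym x∈p)))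
  (filter-partition-≤ (_<? x) (_≟ x) (_<? y) (λ z<x → <-trans z<x x<y) (λ { refl → x<y })
      (λ { z<x refl → <-irrefl refl z<x }) p))

rank-injective : ∀ {p x y} → x ∈ p → y ∈ p → rank p x ≡ rank p y → x ≡ y
rank-injective {x = x} {y} x∈ y∈ eq with <-cmp x y
... | tri< lt _ _ = ⊥-elim (<-irrefl eq (rank-mono-< x∈ lt))
... | tri≈ _ e _  = e
... | tri> _ _ gt = ⊥-elim (<-irrefl (sym eq) (rank-mono-< y∈ gt))

rank-cancel-< : ∀ {p x y} → y ∈ p → rank p x < rank p y → x < y
rank-cancel-< {x = x} {y} y∈ lt with <-cmp x y
... | tri< x<y _ _  = x<y
... | tri≈ _ refl _ = ⊥-elim (<-irrefl refl lt)
... | tri> _ _ gt   = ⊥-elim (<-asym lt (rank-mono-< y∈ gt))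

rank≤length : ∀ {p x} → x ∈ p → rank p x ≤ length p
rank≤length {p} {x} x∈ = filter-notAll (_<? x) p (Any.map (λ { refl → <-irrefl refl }) x∈)

st-length : ∀ p → length (st p) ≡ length p
st-length p = length-map (rank p) p

st-↭iota : ∀ {p} → Unique p → st p ↭ iota (length p)
st-↭iota {p} u = unique-⊆⇒↭ (unique-map⁺ (rank p) rank-injective u) sub
  (≤-reflexive (trans (length-iota (length p)) (sym (st-length p))))
  where
  sub : st p ⊆ iota (length p)
  sub r∈ with ∈-map⁻ (rank p) r∈
  ... | x , x∈ , refl = ∈-iota⁺ (length p) (s≤s z≤n) (rank≤length x∈)

-- `zs` plays the part of the set of positions, and `g` and `h` read off the two lists. Ranks depend
-- only on comparisons between positions; `st-≡⇒mono` is the converse.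
st-cong : (g h : A → ℕ) (zs : List A) →
  (∀ {u v} → u ∈ zs → v ∈ zs → (g u < g v → h u < h v) × (h u < h v → g u < g v)) →
  st (map g zs) ≡ st (map h zs)
st-cong g h zs iso = begin
  map (rank (map g zs)) (map g zs)  ≡⟨ sym (map-∘ zs) ⟩
  map (rank (map g zs) ∘ g) zs      ≡⟨ map-cong-∈ (λ {v} v∈ → cong suc
    (length-filter-cong (_<? g v) (_<? h v) g h zs (λ u∈ → iso u∈ v∈))) ⟩
  map (rank (map h zs) ∘ h) zs      ≡⟨ map-∘ zs ⟩
  map (rank (map h zs)) (map h zs)  ∎
  where open ≡-Reasoning

st-≡⇒mono : (g h : A → ℕ) (zs : List A) → st (map g zs) ≡ st (map h zs) →
  ∀ {u v} → u ∈ zs → v ∈ zs → g u < g v → h u < h v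
st-≡⇒mono g h zs eq u∈ v∈ lt = rank-cancel-< (∈-map⁺ h v∈)
  (subst₂ _<_ (ranks≡ u∈) (ranks≡ v∈) (rank-mono-< (∈-map⁺ g u∈) lt))
  where
  ranks≡ : ∀ {u} → u ∈ zs → rank (map g zs) (g u) ≡ rank (map h zs) (h u)
  ranks≡ = map-≡⇒≡-∈ zs (trans (map-∘ zs) (trans eq (sym (map-∘ zs))))

st-map-rank : ∀ {p} w → w ⊆ p → st (map (rank p) w) ≡ st w
st-map-rank {p} w sub = trans
  (st-cong (rank p) id w (λ u∈ v∈ → rank-cancel-< (sub v∈) , rank-mono-< (sub u∈)))
  (cong st (map-id w))

rank-iota : ∀ n {x} → x ∈ iota n → rank (iota n) x ≡ x
rank-iota (suc n) (here refl) = cong suc (trans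
  (cong length (trans (filter-reject (_<? suc n) {suc n} {iota n} (<-irrefl refl))
    (filter-all (_<? suc n) (All.tabulate λ p → s≤s (proj₂ (∈-iota⁻ n p))))))
  (length-iota n))
rank-iota (suc n) {x} (there p) = trans
  (cong (suc ∘ length) (filter-reject (_<? x) {suc n} {iota n} (≤⇒≯ (m≤n⇒m≤1+n (proj₂ (∈-iota⁻ n p))))))
  (rank-iota n p)

∈S⇒st-≡ : ∀ n {π} → π ∈ S n → st π ≡ π
∈S⇒st-≡ n {π} π∈ = map-id-local (All.tabulate λ {x} x∈ →
  trans (rank-↭ x π↭) (rank-iota n (∈-resp-↭ π↭ x∈)))
  where π↭ = ∈S⇒↭iota n π∈

st-∈S : ∀ {n} {p} → Unique p → length p ≡ n → st p ∈ S n
st-∈S u refl = ↭iota⇒∈S _ (st-↭iota u)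

-- The default 0 is only met when r is not the rank of an entry of p.
select : List ℕ → ℕ → ℕ
select p r = fromMaybe 0 (head (filter (λ x → rank p x ≟ r) p))

select-rank : ∀ {p x} → x ∈ p → select p (rank p x) ≡ x
select-rank {p} {x} x∈
  with filter (λ y → rank p y ≟ rank p x) p
     | ∈-filter⁺ (λ y → rank p y ≟ rank p x) x∈ refl
     | (λ {y} → ∈-filter⁻ (λ y → rank p y ≟ rank p x) {y} {p})
... | y ∷ _ | _ | inv = let y∈ , eq = inv (here refl) in rank-injective y∈ x∈ eq

-- Reads the pattern `τ` in the values of `p`, which reverses `st` once the set of values is known;
-- the order in which `p` lists them does not matter.
arrange : List ℕ → List ℕ → List ℕ
arrange p τ = map (select p) τ

arrange-st : ∀ {p q} → p ↭ q → arrange q (st p) ≡ p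
arrange-st {p} {q} pq = trans (sym (map-∘ p)) (map-id-local (All.tabulate λ {x} x∈ →
  trans (cong (select q) (rank-↭ x pq)) (select-rank (∈-resp-↭ pq x∈))))

arrange-↭ : ∀ {p τ} → Unique p → τ ↭ iota (length p) → arrange p τ ↭ p
arrange-↭ {p} {τ} u τ↭ = ↭-trans
  (↭ₚ.map⁺ (select p) (↭-trans τ↭ (↭-sym (st-↭iota u))))
  (↭-reflexive (arrange-st ↭-refl))

st-arrange : ∀ {p τ} → Unique p → τ ↭ iota (length p) → st (arrange p τ) ≡ τ
st-arrange {p} {τ} u τ↭ = trans (sym (map-∘ τ)) (map-id-local (All.tabulate λ {r} r∈ →
  trans (rank-↭ (select p r) (arrange-↭ u τ↭)) (rank-select (∈-resp-↭ (↭-trans τ↭ (↭-sym (st-↭iota u))) r∈))))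
  where
  rank-select : ∀ {r} → r ∈ st p → rank p (select p r) ≡ r
  rank-select r∈ with ∈-map⁻ (rank p) r∈
  ... | x , x∈ , refl = cong (rank p) (select-rank x∈)

take-length-++ : ∀ {n} (xs ys : List A) → length xs ≡ n → take n (xs ++ ys) ≡ xs
take-length-++ [] ys refl = refl
take-length-++ (x ∷ xs) ys refl = cong (x ∷_) (take-length-++ xs ys refl)

drop-length-++ : ∀ {n} (xs ys : List A) → length xs ≡ n → drop n (xs ++ ys) ≡ ys
drop-length-++ [] ys refl = refl
drop-length-++ (x ∷ xs) ys refl = drop-length-++ xs ys refl

take-⊆ : ∀ n (xs : List A) → take n xs ⊆ xs
take-⊆ n xs p = subst (_ ∈_) (take++drop≡id n xs) (∈-++⁺ˡ p)

drop-⊆ : ∀ n (xs : List A) → drop n xs ⊆ xs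
drop-⊆ n xs p = subst (_ ∈_) (take++drop≡id n xs) (∈-++⁺ʳ (take n xs) p)

st-take-st : ∀ n p → st (take n (st p)) ≡ st (take n p)
st-take-st n p = trans (cong st (take-map n p)) (st-map-rank (take n p) (take-⊆ n p))

st-drop-st : ∀ n p → st (drop n (st p)) ≡ st (drop n p)
st-drop-st n p = trans (cong st (drop-map n p)) (st-map-rank (drop n p) (drop-⊆ n p))

-- Independence of the patterns of two adjacent blocks

count : {P : List ℕ → Set} → Decidable P → ℕ → ℕ
count P? n = length (filter P? (S n))

count-≤! : {P : List ℕ → Set} (P? : Decidable P) (n : ℕ) → count P? n ≤ n !
count-≤! P? n = subst (count P? n ≤_) (length-S n) (length-filter P? (S n))

count-⊤ : ∀ n → count (λ _ → yes tt) n ≡ n !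
count-⊤ n = trans (cong length (filter-all (λ _ → yes tt) (All.tabulate {xs = S n} λ _ → tt))) (length-S n)

≡-to? : (σ : List ℕ) → Decidable (_≡ σ)
≡-to? σ τ = ≡-dec _≟_ τ σ

count-≡-≤1 : ∀ σ n → count (≡-to? σ) n ≤ 1
count-≡-≤1 σ n = unique-⊆⇒length≤ {ys = [ σ ]} (Uniqueₚ.filter⁺ (≡-to? σ) (S-unique n))
  (λ p → here (proj₂ (∈-filter⁻ (≡-to? σ) {xs = S n} p)))

count-≡ : ∀ {σ n} → σ ∈ S n → count (≡-to? σ) n ≡ 1
count-≡ {σ} {n} σ∈ = ≤-antisym (count-≡-≤1 σ n) (filter-some (≡-to? σ) (Any.map sym σ∈))

Block : (List ℕ → Set) → (List ℕ → Set) → ℕ → List ℕ → Set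
Block P Q a π = P (st (take a π)) × Q (st (drop a π))

block? : {P Q : List ℕ → Set} → Decidable P → Decidable Q → ∀ a → Decidable (Block P Q a)
block? P? Q? a π = P? (st (take a π)) ×-dec Q? (st (drop a π))

-- Each block keeps its set of values, so its old arrangement can be rebuilt from the pattern
-- recorded in the first component. Hence the map is its own inverse.
swapPatterns : ℕ → (List ℕ × List ℕ) × List ℕ → (List ℕ × List ℕ) × List ℕ
swapPatterns a ((τ , ρ) , π) =
  (st (take a π) , st (drop a π)) , arrange (take a π) τ ++ arrange (drop a π) ρ

module _ (a b : ℕ) {τ ρ π : List ℕ} (τ∈ : τ ∈ S a) (ρ∈ : ρ ∈ S b) (π∈ : π ∈ S (a + b)) where
  private
    p = take a π
    q = drop a π

    |p| : length p ≡ a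
    |p| = trans (length-take a π) (trans (cong (a ⊓_) (∈S⇒length (a + b) π∈)) (m≤n⇒m⊓n≡m (m≤m+n a b)))

    |q| : length q ≡ b
    |q| = trans (length-drop a π) (trans (cong (_∸ a) (∈S⇒length (a + b) π∈)) (m+n∸m≡n a b))

    p! : Unique p
    p! = Uniqueₚ.take⁺ a (∈S⇒unique (a + b) π∈)

    q! : Unique q
    q! = Uniqueₚ.drop⁺ a (∈S⇒unique (a + b) π∈)

    τ↭ : τ ↭ iota (length p)
    τ↭ = subst (λ n → τ ↭ iota n) (sym |p|) (∈S⇒↭iota a τ∈)

    ρ↭ : ρ ↭ iota (length q)
    ρ↭ = subst (λ n → ρ ↭ iota n) (sym |q|) (∈S⇒↭iota b ρ∈)

    |pτ| : length (arrange p τ) ≡ a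
    |pτ| = trans (length-map (select p) τ) (∈S⇒length a τ∈)

    pτ = arrange p τ
    qρ = arrange q ρ

    take≡ : take a (pτ ++ qρ) ≡ pτ
    take≡ = take-length-++ pτ qρ |pτ|

    drop≡ : drop a (pτ ++ qρ) ≡ qρ
    drop≡ = drop-length-++ pτ qρ |pτ|

  st-take-swap : st (take a (pτ ++ qρ)) ≡ τ
  st-take-swap = trans (cong st take≡) (st-arrange p! τ↭)

  st-drop-swap : st (drop a (pτ ++ qρ)) ≡ ρ
  st-drop-swap = trans (cong st drop≡) (st-arrange q! ρ↭)

  swap-∈S : pτ ++ qρ ∈ S (a + b)
  swap-∈S = ↭iota⇒∈S (a + b) (↭-trans (↭ₚ.++⁺ (arrange-↭ p! τ↭) (arrange-↭ q! ρ↭))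
    (↭-trans (↭-reflexive (take++drop≡id a π)) (∈S⇒↭iota (a + b) π∈)))

  st-take-∈S : st p ∈ S a
  st-take-∈S = st-∈S p! |p|

  st-drop-∈S : st q ∈ S b
  st-drop-∈S = st-∈S q! |q|

  swapPatterns-involutive : swapPatterns a (swapPatterns a ((τ , ρ) , π)) ≡ ((τ , ρ) , π)
  swapPatterns-involutive = cong₂ _,_ (cong₂ _,_ st-take-swap st-drop-swap)
    (trans (cong₂ _++_ (trans (cong (λ l → arrange l (st p)) take≡) (arrange-st (↭-sym (arrange-↭ p! τ↭))))
                       (trans (cong (λ l → arrange l (st q)) drop≡) (arrange-st (↭-sym (arrange-↭ q! ρ↭)))))
           (take++drop≡id a π))

-- Both inequalities come from the involution exchanging the patterns of the two
-- blocks of π with an arbitrary pair of patterns.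
block-count : {P Q : List ℕ → Set} (P? : Decidable P) (Q? : Decidable Q) (a b : ℕ) →
  count P? a * count Q? b * (a + b) ! ≡ a ! * b ! * count (block? P? Q? a) (a + b)
block-count {P} {Q} P? Q? a b = ≤-antisym
  (subst₂ _≤_ |T₁| |T₂| (injection⇒length≤ (swapPatterns a) T₁! into₁ swap-inj₁))
  (subst₂ _≤_ |T₂| |T₁| (injection⇒length≤ (swapPatterns a) T₂! into₂ swap-inj₂))
  where
  R? = block? P? Q? a
  T₁ = cartesianProduct (cartesianProduct (filter P? (S a)) (filter Q? (S b))) (S (a + b))
  T₂ = cartesianProduct (cartesianProduct (S a) (S b)) (filter R? (S (a + b)))

  |T₁| : length T₁ ≡ count P? a * count Q? b * (a + b) !
  |T₁| = trans (length-cartesianProduct (cartesianProduct (filter P? (S a)) (filter Q? (S b))) (S (a + b)))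
    (cong₂ _*_ (length-cartesianProduct (filter P? (S a)) (filter Q? (S b))) (length-S (a + b)))

  |T₂| : length T₂ ≡ a ! * b ! * count R? (a + b)
  |T₂| = trans (length-cartesianProduct (cartesianProduct (S a) (S b)) (filter R? (S (a + b))))
    (cong (_* count R? (a + b)) (trans (length-cartesianProduct (S a) (S b)) (cong₂ _*_ (length-S a) (length-S b))))

  T₁! : Unique T₁
  T₁! = Uniqueₚ.cartesianProduct⁺
    (Uniqueₚ.cartesianProduct⁺ (Uniqueₚ.filter⁺ P? (S-unique a)) (Uniqueₚ.filter⁺ Q? (S-unique b))) (S-unique (a + b))

  T₂! : Unique T₂
  T₂! = Uniqueₚ.cartesianProduct⁺
    (Uniqueₚ.cartesianProduct⁺ (S-unique a) (S-unique b)) (Uniqueₚ.filter⁺ R? (S-unique (a + b)))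

  T₁∈⁻ : ∀ {τ ρ π} → ((τ , ρ) , π) ∈ T₁ → ((τ ∈ S a × P τ) × (ρ ∈ S b × Q ρ)) × π ∈ S (a + b)
  T₁∈⁻ t∈ with ∈-cartesianProduct⁻ (cartesianProduct (filter P? (S a)) (filter Q? (S b))) (S (a + b)) t∈
  ... | τρ∈ , π∈ with ∈-cartesianProduct⁻ (filter P? (S a)) (filter Q? (S b)) τρ∈
  ... | τ∈ , ρ∈ = (∈-filter⁻ P? {xs = S a} τ∈ , ∈-filter⁻ Q? {xs = S b} ρ∈) , π∈

  T₂∈⁻ : ∀ {τ ρ π} → ((τ , ρ) , π) ∈ T₂ → (τ ∈ S a × ρ ∈ S b) × (π ∈ S (a + b) × Block P Q a π)
  T₂∈⁻ t∈ with ∈-cartesianProduct⁻ (cartesianProduct (S a) (S b)) (filter R? (S (a + b))) t∈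
  ... | τρ∈ , π∈ = ∈-cartesianProduct⁻ (S a) (S b) τρ∈ , ∈-filter⁻ R? {xs = S (a + b)} π∈

  into₁ : ∀ {t} → t ∈ T₁ → swapPatterns a t ∈ T₂
  into₁ t∈ with T₁∈⁻ t∈
  ... | ((τ∈ , Pτ) , (ρ∈ , Qρ)) , π∈ = ∈-cartesianProduct⁺
    (∈-cartesianProduct⁺ (st-take-∈S a b τ∈ ρ∈ π∈) (st-drop-∈S a b τ∈ ρ∈ π∈))
    (∈-filter⁺ R? (swap-∈S a b τ∈ ρ∈ π∈)
      (subst P (sym (st-take-swap a b τ∈ ρ∈ π∈)) Pτ , subst Q (sym (st-drop-swap a b τ∈ ρ∈ π∈)) Qρ))

  into₂ : ∀ {t} → t ∈ T₂ → swapPatterns a t ∈ T₁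
  into₂ t∈ with T₂∈⁻ t∈
  ... | (τ∈ , ρ∈) , (π∈ , Pp , Qq) = ∈-cartesianProduct⁺
    (∈-cartesianProduct⁺ (∈-filter⁺ P? (st-take-∈S a b τ∈ ρ∈ π∈) Pp) (∈-filter⁺ Q? (st-drop-∈S a b τ∈ ρ∈ π∈) Qq))
    (swap-∈S a b τ∈ ρ∈ π∈)

  swap-inj₁ : ∀ {t t′} → t ∈ T₁ → t′ ∈ T₁ → swapPatterns a t ≡ swapPatterns a t′ → t ≡ t′
  swap-inj₁ t∈ t′∈ eq with T₁∈⁻ t∈ | T₁∈⁻ t′∈
  ... | ((τ∈ , _) , (ρ∈ , _)) , π∈ | ((τ∈′ , _) , (ρ∈′ , _)) , π∈′ =
    trans (sym (swapPatterns-involutive a b τ∈ ρ∈ π∈)) (trans (cong (swapPatterns a) eq) (swapPatterns-involutive a b τ∈′ ρ∈′ π∈′))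

  swap-inj₂ : ∀ {t t′} → t ∈ T₂ → t′ ∈ T₂ → swapPatterns a t ≡ swapPatterns a t′ → t ≡ t′
  swap-inj₂ t∈ t′∈ eq with T₂∈⁻ t∈ | T₂∈⁻ t′∈
  ... | (τ∈ , ρ∈) , (π∈ , _) | (τ∈′ , ρ∈′) , (π∈′ , _) =
    trans (sym (swapPatterns-involutive a b τ∈ ρ∈ π∈)) (trans (cong (swapPatterns a) eq) (swapPatterns-involutive a b τ∈′ ρ∈′ π∈′))

-- Consecutive occurrences

contains⁻ : ∀ {σ π} → Contains σ π → ∃ λ xs → ∃ λ w → ∃ λ ys → π ≡ xs ++ w ++ ys × st w ≡ σ
contains⁻ {σ} {π} c with find c
... | i , _ , eq = take i π , take (length σ) (drop i π) , drop (length σ) (drop i π) ,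
  sym (trans (cong (take i π ++_) (take++drop≡id (length σ) (drop i π))) (take++drop≡id i π)) , eq

contains⁺ : ∀ {σ} xs w ys → st w ≡ σ → Contains σ (xs ++ w ++ ys)
contains⁺ xs w ys refl = lose (∈-upTo⁺ (s≤s bound≤)) (cong st (trans
  (cong (take (length (st w))) (drop-length-++ xs (w ++ ys) refl))
  (take-length-++ w ys (sym (st-length w)))))
  where
  bound≤ : length xs ≤ length (xs ++ w ++ ys) ∸ length (st w)
  bound≤ rewrite length-++ xs {w ++ ys} | length-++ w {ys} | st-length w
    | sym (+-assoc (length xs) (length w) (length ys)) | +-comm (length xs) (length w)
    | +-assoc (length w) (length xs) (length ys) | m+n∸m≡n (length w) (length xs + length ys) = m≤m+n _ _

-- Makes containment a property of the pattern of a block and not of its values, as `Block`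
-- requires.
st-window : ∀ m i π → st (take m (drop i (st π))) ≡ st (take m (drop i π))
st-window m i π = trans (cong st (trans (cong (take m) (drop-map i π)) (take-map m (drop i π))))
  (st-map-rank (take m (drop i π)) (drop-⊆ i π ∘ take-⊆ m (drop i π)))

contains-st⁺ : ∀ {σ π} → Contains σ π → Contains σ (st π)
contains-st⁺ {σ} {π} c = subst (λ l → Any (λ i → st (take (length σ) (drop i (st π))) ≡ σ) (upTo (suc (l ∸ length σ))))
  (sym (st-length π)) (Any.map (λ {i} eq → trans (st-window (length σ) i π) eq) c)

contains-st⁻ : ∀ {σ π} → Contains σ (st π) → Contains σ π
contains-st⁻ {σ} {π} c = subst (λ l → Any (λ i → st (take (length σ) (drop i π)) ≡ σ) (upTo (suc (l ∸ length σ))))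
  (st-length π) (Any.map (λ {i} eq → trans (sym (st-window (length σ) i π)) eq) c)

contains-++ˡ : ∀ {σ} π π′ → Contains σ π → Contains σ (π ++ π′)
contains-++ˡ π π′ c with contains⁻ c
... | xs , w , ys , refl , eq = subst (Contains _)
  (trans (cong (xs ++_) (sym (++-assoc w ys π′))) (sym (++-assoc xs (w ++ ys) π′))) (contains⁺ xs w (ys ++ π′) eq)

-- Two overlapping occurrences

-- Supplies the common index list that `st-cong` asks for: the pairs of entries in equal positions.
zipped : (xs : List A) (ys : List B) → length xs ≡ length ys →
  ∃ λ zs → xs ≡ map proj₁ zs × ys ≡ map proj₂ zs
zipped [] [] refl = [] , refl , refl
zipped (x ∷ xs) (y ∷ ys) eq with zipped xs ys (suc-injective eq)
... | zs , refl , refl = (x , y) ∷ zs , refl , refl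

SameSt : List (ℕ × ℕ) → Set
SameSt zs = st (map proj₁ zs) ≡ st (map proj₂ zs)

OrderIso : List (ℕ × ℕ) → Set
OrderIso zs = ∀ {u v} → u ∈ zs → v ∈ zs →
  (proj₁ u < proj₁ v → proj₂ u < proj₂ v) × (proj₂ u < proj₂ v → proj₁ u < proj₁ v)

sameSt⇒orderIso : ∀ zs → SameSt zs → OrderIso zs
sameSt⇒orderIso zs eq u∈ v∈ = st-≡⇒mono proj₁ proj₂ zs eq u∈ v∈ , st-≡⇒mono proj₂ proj₁ zs (sym eq) u∈ v∈

-- Any two of the positions already lie together in one of the three shorter lists.
sameSt-glue : ∀ as bs cs → SameSt (as ++ bs) → SameSt (bs ++ cs) → SameSt (as ++ cs) → SameSt (as ++ bs ++ cs)
sameSt-glue as bs cs ab bc ac = st-cong proj₁ proj₂ (as ++ bs ++ cs) λ u∈ v∈ → cases (piece u∈) (piece v∈)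
  where
  AB : OrderIso (as ++ bs)
  AB = sameSt⇒orderIso (as ++ bs) ab
  BC : OrderIso (bs ++ cs)
  BC = sameSt⇒orderIso (bs ++ cs) bc
  AC : OrderIso (as ++ cs)
  AC = sameSt⇒orderIso (as ++ cs) ac

  piece : ∀ {u} → u ∈ as ++ bs ++ cs → u ∈ as ⊎ (u ∈ bs ⊎ u ∈ cs)
  piece u∈ with ∈-++⁻ as u∈
  ... | inj₁ p = inj₁ p
  ... | inj₂ p = inj₂ (∈-++⁻ bs p)

  cases : ∀ {u v} → u ∈ as ⊎ (u ∈ bs ⊎ u ∈ cs) → v ∈ as ⊎ (v ∈ bs ⊎ v ∈ cs) →
    (proj₁ u < proj₁ v → proj₂ u < proj₂ v) × (proj₂ u < proj₂ v → proj₁ u < proj₁ v)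
  cases (inj₁ p) (inj₁ q) = AB (∈-++⁺ˡ p) (∈-++⁺ˡ q)
  cases (inj₁ p) (inj₂ (inj₁ q)) = AB (∈-++⁺ˡ p) (∈-++⁺ʳ as q)
  cases (inj₁ p) (inj₂ (inj₂ q)) = AC (∈-++⁺ˡ p) (∈-++⁺ʳ as q)
  cases (inj₂ (inj₁ p)) (inj₁ q) = AB (∈-++⁺ʳ as p) (∈-++⁺ˡ q)
  cases (inj₂ (inj₁ p)) (inj₂ (inj₁ q)) = BC (∈-++⁺ˡ p) (∈-++⁺ˡ q)
  cases (inj₂ (inj₁ p)) (inj₂ (inj₂ q)) = BC (∈-++⁺ˡ p) (∈-++⁺ʳ bs q)
  cases (inj₂ (inj₂ p)) (inj₁ q) = AC (∈-++⁺ʳ as p) (∈-++⁺ˡ q)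
  cases (inj₂ (inj₂ p)) (inj₂ (inj₁ q)) = BC (∈-++⁺ʳ bs p) (∈-++⁺ˡ q)
  cases (inj₂ (inj₂ p)) (inj₂ (inj₂ q)) = BC (∈-++⁺ʳ bs p) (∈-++⁺ʳ bs q)

st-glue : ∀ as bs cs as′ bs′ cs′ →
  length as ≡ length as′ → length bs ≡ length bs′ → length cs ≡ length cs′ →
  st (as ++ bs) ≡ st (as′ ++ bs′) → st (bs ++ cs) ≡ st (bs′ ++ cs′) → st (as ++ cs) ≡ st (as′ ++ cs′) →
  st (as ++ bs ++ cs) ≡ st (as′ ++ bs′ ++ cs′)
st-glue as bs cs as′ bs′ cs′ eqa eqb eqc ab bc ac
  with zipped as as′ eqa | zipped bs bs′ eqb | zipped cs cs′ eqc
... | za , refl , refl | zb , refl , refl | zc , refl , refl = trans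
  (cong st (sym (map-++³ proj₁))) (trans
  (sameSt-glue za zb zc (pair za zb ab) (pair zb zc bc) (pair za zc ac))
  (cong st (map-++³ proj₂)))
  where
  map-++³ : (f : ℕ × ℕ → ℕ) → map f (za ++ zb ++ zc) ≡ map f za ++ map f zb ++ map f zc
  map-++³ f = trans (map-++ f za (zb ++ zc)) (cong (map f za ++_) (map-++ f zb zc))

  pair : ∀ xs ys → st (map proj₁ xs ++ map proj₁ ys) ≡ st (map proj₂ xs ++ map proj₂ ys) → SameSt (xs ++ ys)
  pair xs ys eq = trans (cong st (map-++ proj₁ xs ys)) (trans eq (cong st (sym (map-++ proj₂ xs ys))))

-- For permutations of length `m + k` this is membership in D k: `drop k` then leaves exactly the
-- last `m` entries.
Ends : List ℕ → ℕ → ℕ → List ℕ → Set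
Ends σ m k ρ = st (take m ρ) ≡ σ × st (drop k ρ) ≡ σ

ends? : ∀ σ m k → Decidable (Ends σ m k)
ends? σ m k ρ = ≡-to? σ (st (take m ρ)) ×-dec ≡-to? σ (st (drop k ρ))

-- With m = k + r, the end windows are `as ++ bs` and `bs ++ cs`, and `bs` is their overlap.
record ThreePieces (k r : ℕ) (ρ : List ℕ) : Set where
  field
    as bs cs : List ℕ
    |as| : length as ≡ k
    |bs| : length bs ≡ r
    |cs| : length cs ≡ k
    ρ≡ : ρ ≡ as ++ bs ++ cs
    take-kr : take (k + r) ρ ≡ as ++ bs
    drop-k : drop k ρ ≡ bs ++ cs

threePieces : ∀ k r ρ → length ρ ≡ k + r + k → ThreePieces k r ρ
threePieces k r ρ |ρ| = record
  { as = as ; bs = bs ; cs = cs ; |as| = |as| ; |bs| = |bs| ; |cs| = |cs| ; ρ≡ = ρ≡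
  ; take-kr = trans (cong (take (k + r)) (trans ρ≡ (sym (++-assoc as bs cs))))
      (take-length-++ (as ++ bs) cs (trans (length-++ as) (cong₂ _+_ |as| |bs|)))
  ; drop-k = sym (take++drop≡id r (drop k ρ)) }
  where
  as = take k ρ
  bs = take r (drop k ρ)
  cs = drop r (drop k ρ)
  ρ≡ : ρ ≡ as ++ bs ++ cs
  ρ≡ = sym (trans (cong (as ++_) (take++drop≡id r (drop k ρ))) (take++drop≡id k ρ))
  |ρ|′ : length ρ ≡ k + (r + k)
  |ρ|′ = trans |ρ| (+-assoc k r k)
  |as| : length as ≡ k
  |as| = trans (length-take k ρ) (trans (cong (k ⊓_) |ρ|′) (m≤n⇒m⊓n≡m (m≤m+n k (r + k))))
  |dk| : length (drop k ρ) ≡ r + k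
  |dk| = trans (length-drop k ρ) (trans (cong (_∸ k) |ρ|′) (m+n∸m≡n k (r + k)))
  |bs| : length bs ≡ r
  |bs| = trans (length-take r (drop k ρ)) (trans (cong (r ⊓_) |dk|) (m≤n⇒m⊓n≡m (m≤m+n r k)))
  |cs| : length cs ≡ k
  |cs| = trans (length-drop r (drop k ρ)) (trans (cong (_∸ r) |dk|) (m+n∸m≡n r k))

-- A permutation whose end windows both have pattern σ is determined by the pattern of
-- its first k and last k entries, and that pattern has prescribed halves.
count-ends : ∀ σ k r → count (ends? σ (k + r) k) (k + r + k) * (k ! * k !) ≤ (k + k) !
count-ends σ k r = begin
  count (ends? σ (k + r) k) (k + r + k) * (k ! * k !)  ≤⟨ *-monoˡ-≤ (k ! * k !) D≤W ⟩
  count W? (k + k) * (k ! * k !)                       ≡⟨ *-comm (count W? (k + k)) (k ! * k !) ⟩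
  k ! * k ! * count W? (k + k)                         ≡⟨ sym (block-count (≡-to? σ₁) (≡-to? σ₂) k k) ⟩
  count (≡-to? σ₁) k * count (≡-to? σ₂) k * (k + k) !
    ≤⟨ *-monoˡ-≤ ((k + k) !) (*-mono-≤ (count-≡-≤1 σ₁ k) (count-≡-≤1 σ₂ k)) ⟩
  1 * 1 * (k + k) !                                    ≡⟨ *-identityˡ ((k + k) !) ⟩
  (k + k) !                                            ∎
  where
  open ≤-Reasoning
  open ThreePieces
  n  = k + r + k
  -- The first `k` entries begin the first window and the last `k` entries end the second one, so
  -- `σ` prescribes the pattern of each. Only the comparisons between the two groups remain free.
  σ₁ = st (take k σ)
  σ₂ = st (drop r σ)
  W? = block? (≡-to? σ₁) (≡-to? σ₂) k
  D  = filter (ends? σ (k + r) k) (S n)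

  outer : List ℕ → List ℕ
  outer ρ = take k ρ ++ drop r (drop k ρ)

  D⁻ : ∀ {ρ} → ρ ∈ D → ρ ∈ S n × Ends σ (k + r) k ρ
  D⁻ = ∈-filter⁻ (ends? σ (k + r) k) {xs = S n}

  pieces : ∀ {ρ} → ρ ∈ S n → ThreePieces k r ρ
  pieces {ρ} ρ∈ = threePieces k r ρ (∈S⇒length n ρ∈)

  outer-unique : ∀ {ρ} → ρ ∈ S n → Unique (outer ρ)
  outer-unique {ρ} ρ∈ = Uniqueₚ.++⁺ (Uniqueₚ.take⁺ k ρ!) (Uniqueₚ.drop⁺ r (Uniqueₚ.drop⁺ k ρ!))
    λ (p , q) → disjoint (subst Unique (sym (take++drop≡id k ρ)) ρ!) p (drop-⊆ r (drop k ρ) q)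
    where
    ρ! = ∈S⇒unique n ρ∈
    disjoint : ∀ {x xs ys} → Unique (xs ++ ys) → x ∈ xs → x ∉ ys
    disjoint {xs = x ∷ xs} (x∉ ∷ _) (here refl) q = All.lookup x∉ (∈-++⁺ʳ xs q) refl
    disjoint (_ ∷ u) (there p) q = disjoint u p q

  into : ∀ {ρ} → ρ ∈ D → st (outer ρ) ∈ filter W? (S (k + k))
  into {ρ} ρ∈D with D⁻ ρ∈D
  ... | ρ∈ , e₁ , e₂ = ∈-filter⁺ W?
    (st-∈S (outer-unique ρ∈) (trans (length-++ (as t)) (cong₂ _+_ (|as| t) (|cs| t))))
    ( trans (st-take-st k (outer ρ)) (trans (cong st (take-length-++ (as t) (cs t) (|as| t)))
        (trans (cong st (sym (take-length-++ (as t) (bs t) (|as| t))))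
        (trans (sym (st-take-st k (as t ++ bs t))) (cong (st ∘ take k) (trans (cong st (sym (take-kr t))) e₁)))))
    , trans (st-drop-st k (outer ρ)) (trans (cong st (drop-length-++ (as t) (cs t) (|as| t)))
        (trans (cong st (sym (drop-length-++ (bs t) (cs t) (|bs| t))))
        (trans (sym (st-drop-st r (bs t ++ cs t))) (cong (st ∘ drop r) (trans (cong st (sym (drop-k t))) e₂))))))
    where t = pieces ρ∈

  inj : ∀ {ρ ρ′} → ρ ∈ D → ρ′ ∈ D → st (outer ρ) ≡ st (outer ρ′) → ρ ≡ ρ′
  inj {ρ} {ρ′} ρ∈D ρ′∈D eq with D⁻ ρ∈D | D⁻ ρ′∈D
  ... | ρ∈ , e₁ , e₂ | ρ′∈ , e₁′ , e₂′ = trans (sym (∈S⇒st-≡ n ρ∈)) (trans (trans (cong st (ρ≡ t)) (trans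
    (st-glue (as t) (bs t) (cs t) (as t′) (bs t′) (cs t′)
      (trans (|as| t) (sym (|as| t′))) (trans (|bs| t) (sym (|bs| t′))) (trans (|cs| t) (sym (|cs| t′)))
      (trans (cong st (sym (take-kr t))) (trans e₁ (trans (sym e₁′) (cong st (take-kr t′)))))
      (trans (cong st (sym (drop-k t))) (trans e₂ (trans (sym e₂′) (cong st (drop-k t′)))))
      eq)
    (cong st (sym (ρ≡ t′))))) (∈S⇒st-≡ n ρ′∈))
    where
    t  = pieces ρ∈
    t′ = pieces ρ′∈

  D≤W : length D ≤ count W? (k + k)
  D≤W = injection⇒length≤ (st ∘ outer) (Uniqueₚ.filter⁺ (ends? σ (k + r) k) (S-unique n)) into inj

-- Occurrences shifted by one, and monotone patterns

module _ {_≺_ : ℕ → ℕ → Set} (≺-trans : Transitive _≺_)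
         (≺-< : ∀ {a b a′ b′} → a ≺ b → a′ ≺ b′ → a < b → a′ < b′)
         (≺-> : ∀ {a b a′ b′} → a ≺ b → a′ ≺ b′ → b < a → b′ < a′) where

  -- The module hypotheses say that `≺` fixes the order of its arguments. Both `<` and `>` do, so
  -- increasing and decreasing lists share this argument.
  st-sorted : ∀ {xs ys} → AllPairs _≺_ xs → AllPairs _≺_ ys → length xs ≡ length ys → st xs ≡ st ys
  st-sorted {xs} {ys} sx sy len with zipped xs ys len
  ... | zs , refl , refl = st-cong proj₁ proj₂ zs (iso zs (AllPairs.zip (AllPairsₚ.map⁻ sx , AllPairsₚ.map⁻ sy)))
    where
    iso : ∀ zs → AllPairs (λ u v → (proj₁ u ≺ proj₁ v) × (proj₂ u ≺ proj₂ v)) zs → OrderIso zs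
    iso (z ∷ zs) (z≺ ∷ s) (here refl) (here refl) =
      (λ lt → ⊥-elim (<-irrefl refl lt)) , (λ lt → ⊥-elim (<-irrefl refl lt))
    iso (z ∷ zs) (z≺ ∷ s) (here refl) (there q) = let p₁ , p₂ = All.lookup z≺ q in ≺-< p₁ p₂ , ≺-< p₂ p₁
    iso (z ∷ zs) (z≺ ∷ s) (there p) (here refl) = let p₁ , p₂ = All.lookup z≺ p in ≺-> p₁ p₂ , ≺-> p₂ p₁
    iso (z ∷ zs) (z≺ ∷ s) (there p) (there q) = iso zs s p q

-- Pairs each entry with its successor, which is the common index list of two windows shifted by
-- one.
steps : ℕ → List ℕ → List (ℕ × ℕ)
steps x []       = []
steps x (y ∷ ys) = (x , y) ∷ steps y ys

steps-proj₁ : ∀ x ys → map proj₁ (steps x ys) ≡ take (length ys) (x ∷ ys)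
steps-proj₁ x [] = refl
steps-proj₁ x (y ∷ ys) = cong (x ∷_) (steps-proj₁ y ys)

steps-proj₂ : ∀ x ys → map proj₂ (steps x ys) ≡ ys
steps-proj₂ x [] = refl
steps-proj₂ x (y ∷ ys) = cong (y ∷_) (steps-proj₂ y ys)

-- The comparison of the first two entries is carried along one position at a time: applied to
-- neighbouring pairs, `iso` turns `x ≺ y` into `y ≺ z`.
steps-linked : {_≺_ : ℕ → ℕ → Set} → ∀ x y ys →
  (∀ {u v} → u ∈ steps x (y ∷ ys) → v ∈ steps x (y ∷ ys) → proj₁ u ≺ proj₁ v → proj₂ u ≺ proj₂ v) →
  x ≺ y → Linked _≺_ (x ∷ y ∷ ys)
steps-linked x y [] iso x≺y = x≺y ∷ [-]
steps-linked x y (z ∷ zs) iso x≺y = x≺y ∷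
  steps-linked y z zs (λ p q → iso (there p) (there q)) (iso (here refl) (there (here refl)) x≺y)

decreasing≡iota : ∀ m → decreasing m ≡ iota m
decreasing≡iota m = trans (sym (reverse-map suc (upTo m))) (trans (cong (map suc) (reverse-upTo m)) (map-suc-downFrom m))
  where
  map-suc-downFrom : ∀ m → map suc (downFrom m) ≡ iota m
  map-suc-downFrom zero = refl
  map-suc-downFrom (suc m) = cong (suc m ∷_) (map-suc-downFrom m)

decreasing-∈S : ∀ m → decreasing m ∈ S m
decreasing-∈S m = ↭iota⇒∈S m (↭-reflexive (decreasing≡iota m))

increasing-∈S : ∀ m → increasing m ∈ S m
increasing-∈S m = ↭iota⇒∈S m (↭-trans (↭-sym (↭ₚ.↭-reverse (increasing m))) (↭-reflexive (decreasing≡iota m)))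

increasing-sorted : ∀ m → AllPairs _<_ (increasing m)
increasing-sorted m = subst (AllPairs _<_) (sym (map-upTo suc m)) (AllPairsₚ.applyUpTo⁺₁ suc m (λ i<j _ → s≤s i<j))

decreasing-sorted : ∀ m → AllPairs _>_ (decreasing m)
decreasing-sorted m = subst (AllPairs _>_) (sym (decreasing≡iota m)) (sorted m)
  where
  sorted : ∀ m → AllPairs _>_ (iota m)
  sorted zero = []
  sorted (suc m) = All.tabulate (λ p → s≤s (proj₂ (∈-iota⁻ m p))) ∷ sorted m

st-increasing : ∀ {m xs} → AllPairs _<_ xs → length xs ≡ m → st xs ≡ increasing m
st-increasing {m} s len = trans
  (st-sorted <-trans (λ _ q _ → q) (λ p _ r → ⊥-elim (<-asym p r)) s (increasing-sorted m)
    (trans len (sym (∈S⇒length m (increasing-∈S m)))))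
  (∈S⇒st-≡ m (increasing-∈S m))

st-decreasing : ∀ {m xs} → AllPairs _>_ xs → length xs ≡ m → st xs ≡ decreasing m
st-decreasing {m} s len = trans
  (st-sorted (λ p q → <-trans q p) (λ p _ r → ⊥-elim (<-asym p r)) (λ _ q _ → q) s (decreasing-sorted m)
    (trans len (sym (∈S⇒length m (decreasing-∈S m)))))
  (∈S⇒st-≡ m (decreasing-∈S m))

-- The first comparison in `ρ` repeats at every position, so `ρ` is monotone, and `σ` is the pattern
-- of its last window.
overlap-one⇒monotone : ∀ {σ m ρ} → ρ ∈ S (m + 1) → Ends σ m 1 ρ → σ ≡ increasing m ⊎ σ ≡ decreasing m
overlap-one⇒monotone {σ} {m} {ρ} ρ∈ (e₁ , e₂) = go ρ (∈S⇒unique (m + 1) ρ∈) (trans (∈S⇒length (m + 1) ρ∈) (+-comm m 1)) e₁ e₂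
  where
  go : ∀ ρ → Unique ρ → length ρ ≡ suc m → st (take m ρ) ≡ σ → st (drop 1 ρ) ≡ σ → σ ≡ increasing m ⊎ σ ≡ decreasing m
  -- Here `m` is 0 and `σ` is empty.
  go (x ∷ []) ρ! refl e₁ e₂ = inj₁ (sym e₁)
  go (x ∷ y ∷ ys) (x∉ ∷ _) refl e₁ e₂ = by-first (<-cmp x y)
    where
    zs = steps x (y ∷ ys)
    iso : OrderIso zs
    iso = sameSt⇒orderIso zs (trans (cong st (steps-proj₁ x (y ∷ ys)))
      (trans e₁ (trans (sym e₂) (cong st (sym (steps-proj₂ x (y ∷ ys)))))))
    by-first : Tri (x < y) (x ≡ y) (y < x) → σ ≡ increasing (suc (length ys)) ⊎ σ ≡ decreasing (suc (length ys))
    by-first (tri< x<y _ _) with Linked⇒AllPairs <-trans (steps-linked x y ys (λ p q → proj₁ (iso p q)) x<y)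
    ... | _ ∷ s = inj₁ (trans (sym e₂) (st-increasing s refl))
    by-first (tri≈ _ refl _) = ⊥-elim (All.lookup x∉ (here refl) refl)
    by-first (tri> _ _ x>y) with Linked⇒AllPairs (λ p q → <-trans q p) (steps-linked x y ys (λ p q → proj₁ (iso q p)) x>y)
    ... | _ ∷ s = inj₂ (trans (sym e₂) (st-decreasing s refl))

-- The recurrence for the number of avoiders

avoids? : ∀ σ → Decidable (λ π → ¬ Contains σ π)
avoids? σ π = ¬? (contains? σ π)

⊤? : Decidable {A = List ℕ} (λ _ → ⊤)
⊤? _ = yes tt

prefixAvoids? : ∀ σ a → Decidable (Block (λ π → ¬ Contains σ π) (λ _ → ⊤) a)
prefixAvoids? σ a = block? (avoids? σ) ⊤? a

avoids-take : ∀ {σ} n π → ¬ Contains σ π → ¬ Contains σ (take n π)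
avoids-take n π av c = av (subst (Contains _) (take++drop≡id n π) (contains-++ˡ (take n π) (drop n π) c))

avoids⇒prefixAvoids : ∀ {σ} a π → ¬ Contains σ π → ¬ Contains σ (st (take a π)) × ⊤
avoids⇒prefixAvoids a π av = avoids-take a π av ∘ contains-st⁻ , tt

-- `block-count` with no condition on the second block, whose factor `b !` is then cancelled.
prefixAvoids-count : ∀ σ a b → α a σ * (a + b) ! ≡ a ! * count (prefixAvoids? σ a) (a + b)
prefixAvoids-count σ a b = *-cancelʳ-≡ _ _ (b !) {{b !≢0}} (begin
  α a σ * (a + b) ! * b !        ≡⟨ *-assoc (α a σ) _ _ ⟩
  α a σ * ((a + b) ! * b !)      ≡⟨ cong (α a σ *_) (*-comm ((a + b) !) (b !)) ⟩
  α a σ * (b ! * (a + b) !)      ≡⟨ sym (*-assoc (α a σ) _ _) ⟩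
  α a σ * b ! * (a + b) !        ≡⟨ cong (λ c → α a σ * c * (a + b) !) (sym (count-⊤ b)) ⟩
  α a σ * count ⊤? b * (a + b) ! ≡⟨ block-count (avoids? σ) ⊤? a b ⟩
  a ! * b ! * X                  ≡⟨ *-assoc (a !) (b !) X ⟩
  a ! * (b ! * X)                ≡⟨ cong (a ! *_) (*-comm (b !) X) ⟩
  a ! * (X * b !)                ≡⟨ sym (*-assoc (a !) X (b !)) ⟩
  a ! * X * b !                  ∎)
  where
  open ≡-Reasoning
  X = count (prefixAvoids? σ a) (a + b)

α-antitone : ∀ σ a b → α (a + b) σ * a ! ≤ α a σ * (a + b) !
α-antitone σ a b = begin
  α (a + b) σ * a !                           ≤⟨ *-monoˡ-≤ (a !) α≤ ⟩
  count (prefixAvoids? σ a) (a + b) * a !     ≡⟨ *-comm _ (a !) ⟩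
  a ! * count (prefixAvoids? σ a) (a + b)     ≡⟨ sym (prefixAvoids-count σ a b) ⟩
  α a σ * (a + b) !                           ∎
  where
  open ≤-Reasoning
  α≤ : α (a + b) σ ≤ count (prefixAvoids? σ a) (a + b)
  α≤ = unique-⊆⇒length≤ (Uniqueₚ.filter⁺ (avoids? σ) (S-unique (a + b))) λ {π} p →
    let π∈ , av = ∈-filter⁻ (avoids? σ) {xs = S (a + b)} p
    in ∈-filter⁺ (prefixAvoids? σ a) π∈ (avoids⇒prefixAvoids a π av)

prefixAvoids-count-1 : ∀ σ n → count (prefixAvoids? σ n) (suc n) ≡ suc n * α n σ
prefixAvoids-count-1 σ n = *-cancelˡ-≡ _ _ (n !) {{n !≢0}} (begin
  n ! * count (prefixAvoids? σ n) (suc n)   ≡⟨ cong (λ l → n ! * count (prefixAvoids? σ n) l) (sym (+-comm n 1)) ⟩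
  n ! * count (prefixAvoids? σ n) (n + 1)   ≡⟨ sym (prefixAvoids-count σ n 1) ⟩
  α n σ * (n + 1) !                         ≡⟨ cong (λ l → α n σ * l !) (+-comm n 1) ⟩
  α n σ * (suc n * n !)                     ≡⟨ sym (*-assoc (α n σ) (suc n) (n !)) ⟩
  α n σ * suc n * n !                       ≡⟨ *-comm (α n σ * suc n) (n !) ⟩
  n ! * (α n σ * suc n)                     ≡⟨ cong (n ! *_) (*-comm (α n σ) (suc n)) ⟩
  n ! * (suc n * α n σ)                     ∎)
  where open ≡-Reasoning

-- The central binomial coefficient grows by the factor (2k + 2)(2k + 1) / (k + 1)², and replacing
-- 2k + 1 by 2k + 2 turns this into 4.
4^k-bound : ∀ k → (k + k) ! ≤ 4 ^ k * (k ! * k !)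
4^k-bound zero = s≤s z≤n
4^k-bound (suc k) rewrite +-suc k k = begin
  suc (suc (k + k)) * (suc (k + k) * (k + k) !)
    ≤⟨ *-mono-≤ (≤-reflexive (cong suc (sym (+-suc k k)))) (*-mono-≤ {suc (k + k)} (n≤1+n (suc (k + k))) (4^k-bound k)) ⟩
  (suc k + suc k) * (suc (suc (k + k)) * (4 ^ k * (k ! * k !)))
    ≡⟨ cong (λ c → (suc k + suc k) * (c * (4 ^ k * (k ! * k !)))) (cong suc (sym (+-suc k k))) ⟩
  (suc k + suc k) * ((suc k + suc k) * (4 ^ k * (k ! * k !)))
    ≡⟨ solve 3 (λ s p f → (s :+ s) :* ((s :+ s) :* (p :* (f :* f))) := con 4 :* p :* (s :* f :* (s :* f))) refl
         (suc k) (4 ^ k) (k !) ⟩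
  4 * 4 ^ k * (suc k * k ! * (suc k * k !)) ∎
  where
  open ≤-Reasoning

count-ends-≤ : ∀ σ k r → count (ends? σ (k + r) k) (k + r + k) ≤ 4 ^ k
count-ends-≤ σ k r = *-cancelʳ-≤ _ _ (k ! * k !) {{m*n≢0 (k !) (k !) {{k !≢0}} {{k !≢0}}}}
  (≤-trans (count-ends σ k r) (4^k-bound k))

-- Permutations whose last window matches the pattern

module Recurrence {σ : List ℕ} {m : ℕ} (σ∈ : σ ∈ S m) where

  lastMatch? : ∀ a → Decidable (Block (λ π → ¬ Contains σ π) (_≡ σ) a)
  lastMatch? a = block? (avoids? σ) (≡-to? σ) a

  overlap? : ∀ a k → Decidable (Block (λ π → ¬ Contains σ π) (Ends σ m k) (a ∸ k))
  overlap? a k = block? (avoids? σ) (ends? σ m k) (a ∸ k)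

  -- The lost permutations: their only match ends at the last entry. The double negation is the
  -- complement of `avoids?`, the form in which they are separated from the avoiders.
  newMatch? : ∀ n → Decidable (λ π → Block (λ π → ¬ Contains σ π) (λ _ → ⊤) n π × ¬ ¬ Contains σ π)
  newMatch? n π = prefixAvoids? σ n π ×-dec ¬? (avoids? σ π)

  lastMatch-count : ∀ a → α a σ * (a + m) ! ≡ a ! * m ! * count (lastMatch? a) (a + m)
  lastMatch-count a = begin
    α a σ * (a + m) !                        ≡⟨ cong (_* (a + m) !) (sym (*-identityʳ (α a σ))) ⟩
    α a σ * 1 * (a + m) !                    ≡⟨ cong (λ c → α a σ * c * (a + m) !) (sym (count-≡ {n = m} σ∈)) ⟩
    α a σ * count (≡-to? σ) m * (a + m) !   ≡⟨ block-count (avoids? σ) (≡-to? σ) a m ⟩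
    a ! * m ! * count (lastMatch? a) (a + m) ∎
    where open ≡-Reasoning

  -- k is the shift from the earlier match to the last one: since the first a entries avoid σ, they overlap.
  match-classify : ∀ a n {π} → a + m ≡ suc n → π ∈ S (suc n) →
    Block (λ π → ¬ Contains σ π) (_≡ σ) a π → Contains σ (take n π) →
    ∃ λ k → 1 ≤ k × k < m × Block (λ π → ¬ Contains σ π) (Ends σ m k) (a ∸ k) π
  match-classify a n {π} a+m≡ π∈ (av , last) c with contains⁻ c
  ... | xs , w , ys , eq , stw =
    a ∸ i , m<n⇒0<n∸m i<a , k<m ,
    subst (λ j → Block (λ π → ¬ Contains σ π) (Ends σ m (a ∸ i)) j π) (sym (m∸[m∸n]≡n (<⇒≤ i<a)))
      ( (λ c′ → av′ (subst (Contains σ) (trans (cong (_++ drop i (take a π)) take-i) (take++drop≡id i (take a π)))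
          (contains-++ˡ (take i π) (drop i (take a π)) (contains-st⁻ c′))))
      , trans (st-take-st m (drop i π)) (trans (cong st (trans (cong (take m) drop-i) (take-length-++ w _ |w|))) stw)
      , trans (st-drop-st (a ∸ i) (drop i π)) (trans (cong st (trans (drop-drop i (a ∸ i) π)
          (cong (λ l → drop l π) (m+[n∸m]≡n (<⇒≤ i<a))))) last))
    where
    i = length xs
    tl = drop n π

    av′ : ¬ Contains σ (take a π)
    av′ = av ∘ contains-st⁺

    |w| : length w ≡ m
    |w| = trans (sym (st-length w)) (trans (cong length stw) (∈S⇒length m σ∈))

    π≡ : π ≡ xs ++ w ++ (ys ++ tl)
    π≡ = trans (sym (take++drop≡id n π)) (trans (cong (_++ tl) eq)
      (trans (++-assoc xs (w ++ ys) tl) (cong (xs ++_) (++-assoc w ys tl))))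

    drop-i : drop i π ≡ w ++ (ys ++ tl)
    drop-i = trans (cong (drop i) π≡) (drop-length-++ xs _ refl)

    i+m≤n : i + m ≤ n
    i+m≤n = begin
      i + m                          ≡⟨ cong (i +_) (sym |w|) ⟩
      i + length w                   ≤⟨ +-monoʳ-≤ i (length-++-≤ˡ w) ⟩
      i + length (w ++ ys)           ≡⟨ sym (length-++ xs) ⟩
      length (xs ++ w ++ ys)         ≡⟨ cong length (sym eq) ⟩
      length (take n π)              ≡⟨ length-take n π ⟩
      n ⊓ length π                   ≤⟨ m⊓n≤m n (length π) ⟩
      n                              ∎
      where open ≤-Reasoning

    -- The match found ends within the first `n` entries and the last one ends at `suc n`, so the
    -- shift is at least 1.
    i<a : i < a
    i<a = +-cancelʳ-≤ m (suc i) a (subst (suc (i + m) ≤_) (sym a+m≡) (s≤s i+m≤n))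

    take-i : take i π ≡ take i (take a π)
    take-i = sym (trans (take-take i a π) (cong (λ l → take l π) (m≤n⇒m⊓n≡m (<⇒≤ i<a))))

    k<m : a ∸ i < m
    k<m with a <? i + m
    ... | yes a<i+m = +-cancelˡ-< i (a ∸ i) m (subst (_< i + m) (sym (m+[n∸m]≡n (<⇒≤ i<a))) a<i+m)
    ... | no a≮i+m = ⊥-elim (av′ (subst (Contains σ) take-a
            (contains⁺ xs w (take (a ∸ (i + m)) (ys ++ tl)) stw)))
      where
      i+m≤a = ≮⇒≥ a≮i+m
      |xs++w| : length (xs ++ w) ≡ i + m
      |xs++w| = trans (length-++ xs) (cong (i +_) |w|)
      take-+ : ∀ (as bs : List ℕ) l → take (length as + l) (as ++ bs) ≡ as ++ take l bs
      take-+ [] bs l = refl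
      take-+ (a ∷ as) bs l = cong (a ∷_) (take-+ as bs l)
      take-a : xs ++ w ++ take (a ∸ (i + m)) (ys ++ tl) ≡ take a π
      take-a = trans (sym (++-assoc xs w _)) (trans (sym (take-+ (xs ++ w) (ys ++ tl) (a ∸ (i + m))))
        (cong₂ take (trans (cong (_+ (a ∸ (i + m))) |xs++w|) (m+[n∸m]≡n i+m≤a))
          (trans (++-assoc xs w (ys ++ tl)) (sym π≡))))

  -- The index `j` stands for the shift `suc j`, so that `j < m ∸ 1` runs through the shifts 1 ≤ k <
  -- m.
  overlaps : ℕ → ℕ → ℕ → List (List ℕ)
  overlaps a n j = filter (overlap? a (suc j)) (S n)

  -- If the first `n` entries avoid `σ`, the last match is new; otherwise `match-classify` gives a
  -- shift. A permutation may admit several shifts, but a union bound suffices.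
  lastMatch-≤ : ∀ a n → a + m ≡ suc n → count (lastMatch? a) (suc n) ≤
    count (newMatch? n) (suc n) + sum (applyUpTo (length ∘ overlaps a (suc n)) (m ∸ 1))
  lastMatch-≤ a n a+m≡ = subst (count (lastMatch? a) (suc n) ≤_)
    (trans (length-++ (filter (newMatch? n) (S (suc n))))
      (cong (count (newMatch? n) (suc n) +_) (length-concat-applyUpTo (overlaps a (suc n)) (m ∸ 1))))
    (unique-⊆⇒length≤ (Uniqueₚ.filter⁺ (lastMatch? a) (S-unique (suc n))) cover)
    where
    cover : filter (lastMatch? a) (S (suc n)) ⊆
      filter (newMatch? n) (S (suc n)) ++ concat (applyUpTo (overlaps a (suc n)) (m ∸ 1))
    cover {π} p with ∈-filter⁻ (lastMatch? a) {xs = S (suc n)} p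
    ... | π∈ , blk@(av , last) with contains? σ (take n π)
    ...   | no ¬c = ∈-++⁺ˡ (∈-filter⁺ (newMatch? n) π∈ ((¬c ∘ contains-st⁻ , tt) , λ av → av lastContains))
      where
      lastContains : Contains σ π
      lastContains = subst (Contains σ) (trans (cong (take a π ++_) (++-identityʳ (drop a π))) (take++drop≡id a π))
        (contains⁺ (take a π) (drop a π) [] last)
    ...   | yes c with match-classify a n a+m≡ π∈ blk c
    ...     | suc j , _ , k<m , ov = ∈-++⁺ʳ (filter (newMatch? n) (S (suc n)))
      (∈-concat⁺′ (∈-filter⁺ (overlap? a (suc j)) π∈ ov)
        (∈-applyUpTo⁺ (overlaps a (suc n)) (∸-monoˡ-≤ 1 k<m)))

  -- Avoiders and lost permutations are disjoint among those whose first `n` entries avoid `σ`, and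
  -- `lastMatch-≤` bounds the number of the lost ones from below.
  α-recurrence : ∀ a n → a + m ≡ suc n →
    α (suc n) σ + count (lastMatch? a) (suc n) ≤
    suc n * α n σ + sum (applyUpTo (length ∘ overlaps a (suc n)) (m ∸ 1))
  α-recurrence a n a+m≡ = begin
    α (suc n) σ + count (lastMatch? a) (suc n)              ≤⟨ +-monoʳ-≤ (α (suc n) σ) (lastMatch-≤ a n a+m≡) ⟩
    α (suc n) σ + (count (newMatch? n) (suc n) + overlapSum) ≡⟨ sym (+-assoc (α (suc n) σ) _ _) ⟩
    α (suc n) σ + count (newMatch? n) (suc n) + overlapSum   ≤⟨ +-monoˡ-≤ overlapSum
      (filter-partition-≤ (avoids? σ) (newMatch? n) (prefixAvoids? σ n)
        (λ {π} → avoids⇒prefixAvoids n π) proj₁ (λ av (_ , ¬av) → ¬av av) (S (suc n))) ⟩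
    count (prefixAvoids? σ n) (suc n) + overlapSum           ≡⟨ cong (_+ overlapSum) (prefixAvoids-count-1 σ n) ⟩
    suc n * α n σ + overlapSum                               ∎
    where
    open ≤-Reasoning
    overlapSum = sum (applyUpTo (length ∘ overlaps a (suc n)) (m ∸ 1))

  -- Monotonicity trades the exact value, in terms of `α a σ`, for a bound in terms of `α n σ`, so
  -- that the loss can be merged with the main term of the recurrence.
  lastMatch-lower : ∀ a n → a + m ≡ suc n → 1 ≤ m → suc n * α n σ ≤ m ! * count (lastMatch? a) (suc n)
  lastMatch-lower a n a+m≡ 1≤m = *-cancelˡ-≤ (a !) {{a !≢0}} (begin
    a ! * (suc n * α n σ)      ≡⟨ solve 3 (λ x y z → x :* (y :* z) := y :* (z :* x)) refl (a !) (suc n) (α n σ) ⟩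
    suc n * (α n σ * a !)      ≤⟨ *-monoʳ-≤ (suc n) anti ⟩
    suc n * (α a σ * n !)      ≡⟨ solve 3 (λ x y z → x :* (y :* z) := y :* (x :* z)) refl (suc n) (α a σ) (n !) ⟩
    α a σ * suc n !            ≡⟨ subst (λ l → α a σ * l ! ≡ a ! * m ! * count (lastMatch? a) l) a+m≡ (lastMatch-count a) ⟩
    a ! * m ! * L              ≡⟨ *-assoc (a !) (m !) L ⟩
    a ! * (m ! * L)            ∎)
    where
    open ≤-Reasoning
    L = count (lastMatch? a) (suc n)
    a+[m-1]≡n : a + (m ∸ 1) ≡ n
    a+[m-1]≡n = trans (sym (+-∸-assoc a 1≤m)) (cong (_∸ 1) a+m≡)
    anti : α n σ * a ! ≤ α a σ * n !
    anti = subst (λ l → α l σ * a ! ≤ α a σ * l !) a+[m-1]≡n (α-antitone σ a (m ∸ 1))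

  overlap-upper : ∀ c k r → k + r ≡ m →
    count (overlap? (c + k) k) (c + (m + k)) * (c ! * (m + k) !) ≤ α c σ * 4 ^ k * (c + (m + k)) !
  overlap-upper c k r refl = begin
    count (overlap? (c + k) k) n * (c ! * (m + k) !)         ≡⟨ *-comm (count (overlap? (c + k) k) n) _ ⟩
    c ! * (m + k) ! * count (overlap? (c + k) k) n
      ≡⟨ cong (λ l → c ! * (m + k) ! * count (block? (avoids? σ) (ends? σ m k) l) n) (m+n∸n≡m c k) ⟩
    c ! * (m + k) ! * count (block? (avoids? σ) (ends? σ m k) c) n
      ≡⟨ sym (block-count (avoids? σ) (ends? σ m k) c (m + k)) ⟩
    α c σ * count (ends? σ m k) (m + k) * n !
      ≤⟨ *-monoˡ-≤ (n !) (*-monoʳ-≤ (α c σ) (count-ends-≤ σ k r)) ⟩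
    α c σ * 4 ^ k * n !                                      ∎
    where
    open ≤-Reasoning
    n = c + (m + k)

  -- This is where the proof uses that `σ` is not monotone; the overlap sum may then start at shift
  -- 2, which gives the error term its second factor 1 / m.
  overlap-one≡0 : σ ≢ increasing m → σ ≢ decreasing m → ∀ a n → a + m ≡ suc n → 1 ≤ a →
    length (overlaps a (suc n) 0) ≡ 0
  overlap-one≡0 ≢inc ≢dec a n a+m≡ 1≤a = cong length (filter-none (overlap? a 1) (All.tabulate none))
    where
    none : ∀ {π} → π ∈ S (suc n) → ¬ Block (λ π → ¬ Contains σ π) (Ends σ m 1) (a ∸ 1) π
    none {π} π∈ (_ , ends) with overlap-one⇒monotone (st-∈S (Uniqueₚ.drop⁺ (a ∸ 1) (∈S⇒unique (suc n) π∈)) len) ends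
      where
      len : length (drop (a ∸ 1) π) ≡ m + 1
      len = begin
        length (drop (a ∸ 1) π) ≡⟨ length-drop (a ∸ 1) π ⟩
        length π ∸ (a ∸ 1)      ≡⟨ cong (_∸ (a ∸ 1)) (trans (∈S⇒length (suc n) π∈) (sym a+m≡)) ⟩
        (a + m) ∸ (a ∸ 1)       ≡⟨ cong (λ x → (x + m) ∸ (a ∸ 1)) (sym (m∸n+n≡m 1≤a)) ⟩
        (a ∸ 1 + 1 + m) ∸ (a ∸ 1) ≡⟨ cong (_∸ (a ∸ 1)) (+-assoc (a ∸ 1) 1 m) ⟩
        (a ∸ 1 + (1 + m)) ∸ (a ∸ 1) ≡⟨ m+n∸m≡n (a ∸ 1) (1 + m) ⟩
        1 + m                   ≡⟨ +-comm 1 m ⟩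
        m + 1                   ∎
        where open ≡-Reasoning
    ... | inj₁ inc = ≢inc inc
    ... | inj₂ dec = ≢dec dec

  -- After multiplication by `m !` the loss cancels one of the `m !` copies of `suc n * α n σ`,
  -- which leaves `L` of them. `z j` counts the overlaps of shift `2 + j`; the growth estimate needs
  -- nothing about them beyond the stated bound.
  avoiders-recurrence : ∀ {L} → 2 ≤ m → m ! ≡ suc L → σ ≢ increasing m → σ ≢ decreasing m →
    ∀ a n → a + m ≡ suc n → m ≤ a → ∃ λ (z : ℕ → ℕ) →
    (m ! * α (suc n) σ ≤ L * (suc n * α n σ) + m ! * sum (applyUpTo z (m ∸ 2))) ×
    (∀ j c → j < m ∸ 2 → c + (2 + j) ≡ a →
      z j * (c ! * (m + (2 + j)) !) ≤ α c σ * 4 ^ (2 + j) * suc n !)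
  avoiders-recurrence {L} 2≤m m!≡ ≢inc ≢dec a n a+m≡ m≤a = z , +-cancelˡ-≤ new _ _ combined , z≤
    where
    open ≤-Reasoning
    z : ℕ → ℕ
    z j = length (overlaps a (suc n) (suc j))
    Z = sum (applyUpTo z (m ∸ 2))
    new = suc n * α n σ
    Y = count (lastMatch? a) (suc n)

    overlapSum≡ : sum (applyUpTo (length ∘ overlaps a (suc n)) (m ∸ 1)) ≡ Z
    overlapSum≡ = trans (cong (λ l → sum (applyUpTo (length ∘ overlaps a (suc n)) (l ∸ 1))) (sym (m+[n∸m]≡n 2≤m)))
      (cong (_+ Z) (overlap-one≡0 ≢inc ≢dec a n a+m≡ (≤-trans (≤-trans (n≤1+n 1) 2≤m) m≤a)))

    combined : new + m ! * α (suc n) σ ≤ new + (L * new + m ! * Z)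
    combined = begin
      new + m ! * α (suc n) σ          ≤⟨ +-monoˡ-≤ _ (lastMatch-lower a n a+m≡ (≤-trans (n≤1+n 1) 2≤m)) ⟩
      m ! * Y + m ! * α (suc n) σ      ≡⟨ trans (sym (*-distribˡ-+ (m !) Y _)) (cong (m ! *_) (+-comm Y _)) ⟩
      m ! * (α (suc n) σ + Y)          ≤⟨ *-monoʳ-≤ (m !) (subst (λ x → α (suc n) σ + Y ≤ new + x) overlapSum≡ (α-recurrence a n a+m≡)) ⟩
      m ! * (new + Z)                  ≡⟨ *-distribˡ-+ (m !) new Z ⟩
      m ! * new + m ! * Z              ≡⟨ cong (λ x → x * new + m ! * Z) m!≡ ⟩
      new + L * new + m ! * Z          ≡⟨ +-assoc new (L * new) (m ! * Z) ⟩
      new + (L * new + m ! * Z)        ∎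

    z≤ : ∀ j c → j < m ∸ 2 → c + (2 + j) ≡ a → z j * (c ! * (m + (2 + j)) !) ≤ α c σ * 4 ^ (2 + j) * suc n !
    z≤ j c j< c+k≡a = subst₂ (λ x l → count (overlap? x k) l * (c ! * (m + k) !) ≤ α c σ * 4 ^ k * l !)
      c+k≡a (trans (solve 3 (λ c m k → c :+ (m :+ k) := c :+ k :+ m) refl c m k) (trans (cong (_+ m) c+k≡a) a+m≡))
      (overlap-upper c k (m ∸ k) (m+[n∸m]≡n k≤m))
      where
      k = 2 + j
      k≤m : k ≤ m
      k≤m = ≤-trans (+-monoʳ-≤ 2 (<⇒≤ j<)) (≤-reflexive (m+[n∸m]≡n 2≤m))

-- Growth estimates

sum-geometric : ∀ (z : ℕ → ℕ) J c U → (∀ j → j < J → z j * 2 ^ j * c ≤ U) → sum (applyUpTo z J) * c ≤ 2 * U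
sum-geometric z zero c U hz = z≤n
sum-geometric z (suc J) c U hz = begin
  (z 0 + tail) * c       ≡⟨ *-distribʳ-+ c (z 0) tail ⟩
  z 0 * c + tail * c     ≤⟨ +-mono-≤ head≤ tail≤ ⟩
  U + U                  ≡⟨ cong (U +_) (sym (+-identityʳ U)) ⟩
  2 * U                  ∎
  where
  open ≤-Reasoning
  tail = sum (applyUpTo (z ∘ suc) J)
  head≤ : z 0 * c ≤ U
  head≤ = subst (λ x → x * c ≤ U) (*-identityʳ (z 0)) (hz 0 z<s)
  tail≤ : tail * c ≤ U
  tail≤ = *-cancelˡ-≤ 2 (subst (_≤ 2 * U) (solve 2 (λ t c → t :* (con 2 :* c) := con 2 :* (t :* c)) refl tail c)
    (sum-geometric (z ∘ suc) J (2 * c) U λ j j<J → subst (_≤ U)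
      (solve 3 (λ y p c → y :* (con 2 :* p) :* c := y :* p :* (con 2 :* c)) refl (z (suc j)) (2 ^ j) c)
      (hz (suc j) (s≤s j<J))))

-- Bernoulli's inequality (1 - 1/l)^j ≥ 1 - j/l for l = `suc L`, cleared of denominators and
-- subtraction.
bernoulli : ∀ L j → suc L ^ j * suc L ≤ L ^ j * suc L + j * suc L ^ j
bernoulli L zero = m≤m+n _ 0
bernoulli L (suc j) = begin
  l * l ^ j * l                                ≡⟨ *-assoc l (l ^ j) l ⟩
  l * (l ^ j * l)                              ≤⟨ *-monoʳ-≤ l (bernoulli L j) ⟩
  l * (L ^ j * l + j * l ^ j)                  ≡⟨ solve 4 (λ L a j b → (con 1 :+ L) :* (a :* (con 1 :+ L) :+ j :* b)
      := L :* a :* (con 1 :+ L) :+ (a :* (con 1 :+ L) :+ j :* ((con 1 :+ L) :* b))) refl L (L ^ j) j (l ^ j) ⟩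
  L * L ^ j * l + (L ^ j * l + j * (l * l ^ j)) ≤⟨ +-monoʳ-≤ (L * L ^ j * l) (+-monoˡ-≤ (j * (l * l ^ j))
      (≤-trans (*-monoˡ-≤ l (^-monoˡ-≤ j (n≤1+n L))) (≤-reflexive (*-comm (l ^ j) l)))) ⟩
  L * L ^ j * l + (l * l ^ j + j * (l * l ^ j)) ∎
  where
  open ≤-Reasoning
  l = suc L

pow-ratio-≤2 : ∀ L j → 2 * j ≤ suc L → suc L ^ j ≤ 2 * L ^ j
pow-ratio-≤2 L j 2j≤ = *-cancelʳ-≤ _ _ l (+-cancelʳ-≤ (l ^ j * l) _ _ (begin
  l ^ j * l + l ^ j * l                     ≡⟨ solve 2 (λ a l → a :* l :+ a :* l := con 2 :* (a :* l)) refl (l ^ j) l ⟩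
  2 * (l ^ j * l)                           ≤⟨ *-monoʳ-≤ 2 (bernoulli L j) ⟩
  2 * (L ^ j * l + j * l ^ j)               ≡⟨ solve 4 (λ b l j a → con 2 :* (b :* l :+ j :* a)
                                                 := con 2 :* b :* l :+ a :* (con 2 :* j)) refl (L ^ j) l j (l ^ j) ⟩
  2 * L ^ j * l + l ^ j * (2 * j)           ≤⟨ +-monoʳ-≤ (2 * L ^ j * l) (*-monoʳ-≤ (l ^ j) 2j≤) ⟩
  2 * L ^ j * l + l ^ j * l                 ∎))
  where
  open ≤-Reasoning
  l = suc L

^-distribʳ-* : ∀ j a b → (a * b) ^ j ≡ a ^ j * b ^ j
^-distribʳ-* zero a b = refl
^-distribʳ-* (suc j) a b = trans (cong (a * b *_) (^-distribʳ-* j a b)) ([m*n]*[o*p]≡[m*o]*[n*p] a b (a ^ j) (b ^ j))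

bernoulli-suc : ∀ q n → q ^ n * (q + n) ≤ q * suc q ^ n
bernoulli-suc q zero = ≤-reflexive (solve 1 (λ q → con 1 :* (q :+ con 0) := q :* con 1) refl q)
bernoulli-suc q (suc n) = begin
  q * q ^ n * (q + suc n)
    ≤⟨ m≤m+n _ (q ^ n * n) ⟩
  q * q ^ n * (q + suc n) + q ^ n * n
    ≡⟨ solve 3 (λ q p n → q :* p :* (q :+ (con 1 :+ n)) :+ p :* n := (con 1 :+ q) :* (p :* (q :+ n))) refl q (q ^ n) n ⟩
  suc q * (q ^ n * (q + n))
    ≤⟨ *-monoʳ-≤ (suc q) (bernoulli-suc q n) ⟩
  suc q * (q * suc q ^ n)
    ≡⟨ solve 2 (λ q p → (con 1 :+ q) :* (q :* p) := q :* ((con 1 :+ q) :* p)) refl q (suc q ^ n) ⟩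
  q * (suc q * suc q ^ n) ∎
  where open ≤-Reasoning

-- From (1 + 1/q)^n ≥ 1 + n/q, which is at least 2 once n ≥ q. It serves to absorb the factor 2 of
-- the growth estimate.
pow-double : ∀ q n .{{_ : NonZero q}} → q ≤ n → 2 * q ^ n ≤ suc q ^ n
pow-double q n q≤n = *-cancelˡ-≤ q (begin
  q * (2 * q ^ n)    ≡⟨ solve 2 (λ q p → q :* (con 2 :* p) := p :* (q :+ q)) refl q (q ^ n) ⟩
  q ^ n * (q + q)    ≤⟨ *-monoʳ-≤ (q ^ n) (+-monoʳ-≤ q q≤n) ⟩
  q ^ n * (q + n)    ≤⟨ bernoulli-suc q n ⟩
  q * suc q ^ n      ∎)
  where open ≤-Reasoning

n≤n! : ∀ n → n ≤ n !
n≤n! zero = z≤n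
n≤n! (suc n) = subst (_≤ suc n * n !) (*-identityʳ (suc n)) (*-monoʳ-≤ (suc n) (1≤n! n))

-- For k = 2 + j this supplies the m² of the error term and leaves m ^ j to make the overlap sum
-- converge.
!*^-≤ : ∀ m k → m ! * m ^ k ≤ (m + k) !
!*^-≤ m zero = ≤-reflexive (trans (*-identityʳ (m !)) (cong _! (sym (+-identityʳ m))))
!*^-≤ m (suc k) rewrite +-suc m k = begin
  m ! * (m * m ^ k)       ≡⟨ solve 3 (λ f m p → f :* (m :* p) := m :* (f :* p)) refl (m !) m (m ^ k) ⟩
  m * (m ! * m ^ k)       ≤⟨ *-mono-≤ (≤-trans (m≤m+n m k) (n≤1+n (m + k))) (!*^-≤ m k) ⟩
  suc (m + k) * (m + k) ! ∎
  where open ≤-Reasoning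

-- Successive overlap bounds shrink by 4 / m, which is at most 1 / 2 from `m` = 8 on, as
-- `sum-geometric` requires.
2^j*4^j≤ : ∀ m j → 8 ≤ m → 2 ^ j * 4 ^ j ≤ m ^ j
2^j*4^j≤ m zero 8≤m = ≤-refl
2^j*4^j≤ m (suc j) 8≤m = begin
  2 * 2 ^ j * (4 * 4 ^ j)  ≡⟨ solve 2 (λ a b → con 2 :* a :* (con 4 :* b) := con 8 :* (a :* b)) refl (2 ^ j) (4 ^ j) ⟩
  8 * (2 ^ j * 4 ^ j)      ≤⟨ *-mono-≤ 8≤m (2^j*4^j≤ m j 8≤m) ⟩
  m * m ^ j                ∎
  where open ≤-Reasoning

4m≤m! : ∀ m → 8 ≤ m → 4 * m ≤ m !
4m≤m! (suc m) (s≤s 7≤m) = subst (_≤ suc m * m !) (*-comm (suc m) 4)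
  (*-monoʳ-≤ (suc m) (≤-trans (≤-trans (s≤s (s≤s (s≤s (s≤s z≤n)))) 7≤m) (n≤n! m)))

-- R / D is the claimed rate 1 - 1/m! + 64/(m² m!), with m! = suc L.
module Growth (A : ℕ → ℕ) (A≤! : ∀ n → A n ≤ n !) (m L : ℕ) (8≤m : 8 ≤ m) (m!≡ : m ! ≡ suc L)
  (recurrence : ∀ a n → a + m ≡ suc n → m ≤ a → ∃ λ (z : ℕ → ℕ) →
    (m ! * A (suc n) ≤ L * (suc n * A n) + m ! * sum (applyUpTo z (m ∸ 2))) ×
    (∀ j c → j < m ∸ 2 → c + (2 + j) ≡ a →
      z j * (c ! * (m + (2 + j)) !) ≤ A c * 4 ^ (2 + j) * suc n !)) where

  D R : ℕ
  D = m * m * m !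
  R = m * m * L + 64

  private
    -- Already (1 - 1/m!)^j is at least 1 / 2 in this range, because 4m ≤ m!; the summand 64 in `R`
    -- only helps.
    D^≤2R^ : ∀ j → j ≤ 2 * m → D ^ j ≤ 2 * R ^ j
    D^≤2R^ j j≤ = begin
      D ^ j                        ≡⟨ cong (λ x → (m * m * x) ^ j) m!≡ ⟩
      (m * m * suc L) ^ j          ≡⟨ ^-distribʳ-* j (m * m) (suc L) ⟩
      (m * m) ^ j * suc L ^ j      ≤⟨ *-monoʳ-≤ ((m * m) ^ j) (pow-ratio-≤2 L j (≤-trans (*-monoʳ-≤ 2 j≤) 4m≤)) ⟩
      (m * m) ^ j * (2 * L ^ j)    ≡⟨ solve 2 (λ a b → a :* (con 2 :* b) := con 2 :* (a :* b)) refl ((m * m) ^ j) (L ^ j) ⟩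
      2 * ((m * m) ^ j * L ^ j)    ≡⟨ cong (2 *_) (sym (^-distribʳ-* j (m * m) L)) ⟩
      2 * (m * m * L) ^ j          ≤⟨ *-monoʳ-≤ 2 (^-monoˡ-≤ j (m≤m+n (m * m * L) 64)) ⟩
      2 * R ^ j                    ∎
      where
      open ≤-Reasoning
      4m≤ : 2 * (2 * m) ≤ suc L
      4m≤ = subst₂ _≤_ (*-assoc 2 2 m) m!≡ (4m≤m! m 8≤m)

    -- The factor 64 is 16 from 4 ^ (2 + j), times 2 from the induction hypothesis at c, times 2
    -- from reaching back e steps. Factorials and powers are variables here so that the ring solver
    -- meets only atoms.
    overlap-term : ∀ z cf mk Ac nf p₂ p₄ Dc De Rc Re .{{_ : NonZero cf}} .{{_ : NonZero p₄}} →
      z * (cf * mk) ≤ Ac * (16 * p₄) * nf → Ac * Dc ≤ 2 * cf * Rc → De ≤ 2 * Re →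
      m ! * (m * m * (p₂ * p₄)) ≤ mk →
      z * p₂ * (m ! * (m * m) * (Dc * De)) ≤ 64 * nf * (Rc * Re)
    overlap-term z cf mk Ac nf p₂ p₄ Dc De Rc Re hz hA hD hm = *-cancelʳ-≤ _ _ (cf * p₄) {{m*n≢0 cf p₄}} (begin
      z * p₂ * (m ! * (m * m) * (Dc * De)) * (cf * p₄)
        ≡⟨ solve 8 (λ z p₂ M m Dc De cf p₄ → z :* p₂ :* (M :* (m :* m) :* (Dc :* De)) :* (cf :* p₄)
             := z :* (cf :* (M :* (m :* m :* (p₂ :* p₄)))) :* (Dc :* De)) refl z p₂ (m !) m Dc De cf p₄ ⟩
      z * (cf * (m ! * (m * m * (p₂ * p₄)))) * (Dc * De)
        ≤⟨ *-monoˡ-≤ (Dc * De) (*-monoʳ-≤ z (*-monoʳ-≤ cf hm)) ⟩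
      z * (cf * mk) * (Dc * De)
        ≤⟨ *-monoˡ-≤ (Dc * De) hz ⟩
      Ac * (16 * p₄) * nf * (Dc * De)
        ≡⟨ solve 5 (λ Ac p₄ nf Dc De → Ac :* (con 16 :* p₄) :* nf :* (Dc :* De)
             := Ac :* Dc :* De :* (con 16 :* p₄ :* nf)) refl Ac p₄ nf Dc De ⟩
      Ac * Dc * De * (16 * p₄ * nf)
        ≤⟨ *-monoˡ-≤ (16 * p₄ * nf) (*-mono-≤ hA hD) ⟩
      2 * cf * Rc * (2 * Re) * (16 * p₄ * nf)
        ≡⟨ solve 5 (λ cf Rc Re p₄ nf → con 2 :* cf :* Rc :* (con 2 :* Re) :* (con 16 :* p₄ :* nf)
             := con 64 :* nf :* (Rc :* Re) :* (cf :* p₄)) refl cf Rc Re p₄ nf ⟩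
      64 * nf * (Rc * Re) * (cf * p₄) ∎)
      where open ≤-Reasoning

  growth : ∀ n → A n * D ^ n ≤ 2 * n ! * R ^ n
  growth = <-rec _ step
    where
    open ≤-Reasoning
    step : ∀ n → (∀ {k} → k < n → A k * D ^ k ≤ 2 * k ! * R ^ k) → A n * D ^ n ≤ 2 * n ! * R ^ n
    step n ih with n ≤? 2 * m
    -- R / D to the power `n` is still at least 1 / 2 here, so the trivial bound `n !` is enough;
    -- the factor 2 in the claim pays for this.
    step n ih | yes n≤ = begin
      A n * D ^ n         ≤⟨ *-mono-≤ (A≤! n) (D^≤2R^ n n≤) ⟩
      n ! * (2 * R ^ n)   ≡⟨ solve 2 (λ a b → a :* (con 2 :* b) := con 2 :* a :* b) refl (n !) (R ^ n) ⟩
      2 * n ! * R ^ n     ∎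
    step zero ih | no n≰ with () ← n≰ z≤n
    step (suc n) ih | no n≰ = begin
      A (suc n) * (D * D ^ n)
        ≡⟨ solve 4 (λ a M m d → a :* (m :* m :* M :* d) := m :* m :* d :* (M :* a)) refl (A (suc n)) (m !) m (D ^ n) ⟩
      m * m * D ^ n * (m ! * A (suc n))
        ≤⟨ *-monoʳ-≤ (m * m * D ^ n) rec≤ ⟩
      m * m * D ^ n * (L * (suc n * A n) + m ! * Z)
        ≡⟨ solve 7 (λ m d L s a M z → m :* m :* d :* (L :* (s :* a) :+ M :* z)
             := m :* m :* L :* s :* (a :* d) :+ z :* (M :* (m :* m) :* d)) refl m (D ^ n) L (suc n) (A n) (m !) Z ⟩
      m * m * L * suc n * (A n * D ^ n) + Z * (m ! * (m * m) * D ^ n)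
        -- The main term yields the part `m * m * L` of `R`, and the overlap sum yields the part 64.
        ≤⟨ +-mono-≤ (*-monoʳ-≤ (m * m * L * suc n) (ih ≤-refl))
             (sum-geometric z (m ∸ 2) (m ! * (m * m) * D ^ n) (64 * suc n ! * R ^ n) term) ⟩
      m * m * L * suc n * (2 * n ! * R ^ n) + 2 * (64 * (suc n * n !) * R ^ n)
        ≡⟨ solve 5 (λ m L s f r → m :* m :* L :* s :* (con 2 :* f :* r) :+ con 2 :* (con 64 :* (s :* f) :* r)
             := con 2 :* (s :* f) :* ((m :* m :* L :+ con 64) :* r)) refl m L (suc n) (n !) (R ^ n) ⟩
      2 * suc n ! * (R * R ^ n) ∎
      where
      a = suc n ∸ m
      2m≤ : m + m ≤ suc n
      2m≤ = <⇒≤ (subst (_< suc n) (cong (m +_) (+-identityʳ m)) (≰⇒> n≰))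
      m≤n : m ≤ suc n
      m≤n = ≤-trans (m≤m+n m m) 2m≤
      m≤a : m ≤ a
      m≤a = subst (_≤ a) (m+n∸m≡n m m) (∸-monoˡ-≤ m 2m≤)
      rec = recurrence a n (m∸n+n≡m m≤n) m≤a
      z = proj₁ rec
      rec≤ = proj₁ (proj₂ rec)
      z≤ = proj₂ (proj₂ rec)
      Z = sum (applyUpTo z (m ∸ 2))
      term : ∀ j → j < m ∸ 2 → z j * 2 ^ j * (m ! * (m * m) * D ^ n) ≤ 64 * suc n ! * R ^ n
      term j j< = subst₂ (λ d r → z j * 2 ^ j * (m ! * (m * m) * d) ≤ 64 * suc n ! * r)
        (trans (sym (^-distribˡ-+-* D c e)) (cong (D ^_) c+e≡n))
        (trans (sym (^-distribˡ-+-* R c e)) (cong (R ^_) c+e≡n))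
        (overlap-term (z j) (c !) ((m + k) !) (A c) (suc n !) (2 ^ j) (4 ^ j) (D ^ c) (D ^ e) (R ^ c) (R ^ e)
          {{c !≢0}} {{m^n≢0 4 j}}
          (subst (λ x → z j * (c ! * (m + k) !) ≤ A c * x * suc n !) (sym (*-assoc 4 4 (4 ^ j))) (z≤ j c j< c+k≡a))
          (ih (s≤s (≤-trans (m≤m+n c e) (≤-reflexive c+e≡n))))
          (D^≤2R^ e e≤2m)
          (≤-trans (*-monoʳ-≤ (m !) (≤-trans (*-monoʳ-≤ (m * m) (2^j*4^j≤ m j 8≤m)) (≤-reflexive (*-assoc m m (m ^ j)))))
            (!*^-≤ m k)))
        where
        k = 2 + j
        k≤m : k ≤ m
        k≤m = ≤-trans (+-monoʳ-≤ 2 (<⇒≤ j<)) (≤-reflexive (m+[n∸m]≡n (≤-trans (s≤s (s≤s z≤n)) 8≤m)))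
        c = a ∸ k
        -- This is n - c, namely m + k - 1: one factor `D` has been split off, so the comparison is
        -- with `n` and not `suc n`.
        e = m + suc j
        c+k≡a : c + k ≡ a
        c+k≡a = m∸n+n≡m (≤-trans k≤m m≤a)
        c+e≡n : c + e ≡ n
        c+e≡n = suc-injective (trans (solve 3 (λ c m j → con 1 :+ (c :+ (m :+ (con 1 :+ j))) := c :+ (con 2 :+ j) :+ m) refl c m j)
          (trans (cong (_+ m) c+k≡a) (m∸n+n≡m m≤n)))
        e≤2m : e ≤ 2 * m
        e≤2m = ≤-trans (+-monoʳ-≤ m (≤-trans (n≤1+n (suc j)) k≤m)) (≤-reflexive (cong (m +_) (sym (+-identityʳ m))))

-- Passage to the rationals

toℚᵘ-ℕ→ℚ : ∀ n → ℚ.toℚᵘ (ℕ→ℚ n) ℚᵘ.≃ mkℚᵘ (ℤ.+ n) 0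
toℚᵘ-ℕ→ℚ n = ℚₚ.toℚᵘ-fromℚᵘ (mkℚᵘ (ℤ.+ n) 0)

ℕ→ℚ-homo-* : ∀ a b → ℕ→ℚ (a * b) ≡ ℕ→ℚ a ℚ.* ℕ→ℚ b
ℕ→ℚ-homo-* a b = ℚₚ.toℚᵘ-injective (begin
  ℚ.toℚᵘ (ℕ→ℚ (a * b))                       ≈⟨ toℚᵘ-ℕ→ℚ (a * b) ⟩
  mkℚᵘ (ℤ.+ (a * b)) 0                       ≈⟨ *≡* (cong (ℤ._* ℤ.1ℤ) (ℤₚ.pos-* a b)) ⟩
  mkℚᵘ (ℤ.+ a) 0 ℚᵘ.* mkℚᵘ (ℤ.+ b) 0         ≈⟨ ℚᵘₚ.*-cong (toℚᵘ-ℕ→ℚ a) (toℚᵘ-ℕ→ℚ b) ⟨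
  ℚ.toℚᵘ (ℕ→ℚ a) ℚᵘ.* ℚ.toℚᵘ (ℕ→ℚ b)         ≈⟨ ℚₚ.toℚᵘ-homo-* (ℕ→ℚ a) (ℕ→ℚ b) ⟨
  ℚ.toℚᵘ (ℕ→ℚ a ℚ.* ℕ→ℚ b)                   ∎)
  where open ℚᵘₚ.≃-Reasoning

ℕ→ℚ-homo-+ : ∀ a b → ℕ→ℚ (a + b) ≡ ℕ→ℚ a ℚ.+ ℕ→ℚ b
ℕ→ℚ-homo-+ a b = ℚₚ.toℚᵘ-injective (begin
  ℚ.toℚᵘ (ℕ→ℚ (a + b))                       ≈⟨ toℚᵘ-ℕ→ℚ (a + b) ⟩
  mkℚᵘ (ℤ.+ (a + b)) 0                       ≈⟨ *≡* (cong (ℤ._* ℤ.1ℤ)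
    (cong₂ ℤ._+_ (sym (ℤₚ.*-identityʳ (ℤ.+ a))) (sym (ℤₚ.*-identityʳ (ℤ.+ b))))) ⟩
  mkℚᵘ (ℤ.+ a) 0 ℚᵘ.+ mkℚᵘ (ℤ.+ b) 0         ≈⟨ ℚᵘₚ.+-cong (toℚᵘ-ℕ→ℚ a) (toℚᵘ-ℕ→ℚ b) ⟨
  ℚ.toℚᵘ (ℕ→ℚ a) ℚᵘ.+ ℚ.toℚᵘ (ℕ→ℚ b)         ≈⟨ ℚₚ.toℚᵘ-homo-+ (ℕ→ℚ a) (ℕ→ℚ b) ⟨
  ℚ.toℚᵘ (ℕ→ℚ a ℚ.+ ℕ→ℚ b)                   ∎)
  where open ℚᵘₚ.≃-Reasoning

ℕ→ℚ-mono-≤ : ∀ {a b} → a ≤ b → ℕ→ℚ a ℚ.≤ ℕ→ℚ b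
ℕ→ℚ-mono-≤ {a} {b} a≤b = ℚₚ.toℚᵘ-cancel-≤ (begin
  ℚ.toℚᵘ (ℕ→ℚ a)     ≃⟨ toℚᵘ-ℕ→ℚ a ⟩
  mkℚᵘ (ℤ.+ a) 0     ≤⟨ *≤* (ℤₚ.*-monoʳ-≤-nonNeg ℤ.1ℤ (ℤ.+≤+ a≤b)) ⟩
  mkℚᵘ (ℤ.+ b) 0     ≃⟨ toℚᵘ-ℕ→ℚ b ⟨
  ℚ.toℚᵘ (ℕ→ℚ b)     ∎)
  where open ℚᵘₚ.≤-Reasoning

ℕ→ℚ-nonNeg : ∀ n → ℚ.NonNegative (ℕ→ℚ n)
ℕ→ℚ-nonNeg n = ℚₚ.normalize-nonNeg n 1

ℕ→ℚ-pos : ∀ n .{{_ : NonZero n}} → ℚ.Positive (ℕ→ℚ n)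
ℕ→ℚ-pos n = ℚₚ.normalize-pos n 1

inv-* : ∀ n .{{_ : NonZero n}} → inv n ℚ.* ℕ→ℚ n ≡ 1ℚ
inv-* (suc k) = ℚₚ.toℚᵘ-injective (begin
  ℚ.toℚᵘ (inv (suc k) ℚ.* ℕ→ℚ (suc k))               ≈⟨ ℚₚ.toℚᵘ-homo-* (inv (suc k)) (ℕ→ℚ (suc k)) ⟩
  ℚ.toℚᵘ (inv (suc k)) ℚᵘ.* ℚ.toℚᵘ (ℕ→ℚ (suc k))
    ≈⟨ ℚᵘₚ.*-cong (ℚₚ.toℚᵘ-fromℚᵘ (mkℚᵘ (ℤ.+ 1) k)) (toℚᵘ-ℕ→ℚ (suc k)) ⟩
  mkℚᵘ (ℤ.+ 1) k ℚᵘ.* mkℚᵘ (ℤ.+ suc k) 0             ≈⟨ *≡* (cong (ℤ.+_) (cong suc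
    (solve 1 (λ k → (k :+ con 0) :* con 1 := k :* con 1 :+ con 0) refl k))) ⟩
  mkℚᵘ (ℤ.+ 1) 0                                     ∎)
  where open ℚᵘₚ.≃-Reasoning

-- A positive fraction has numerator at least 1. Its denominator d thus gives 1/d ≤ ε explicitly,
-- and it later serves as the threshold for `n` too.
1≤ε*denominator : ∀ ε → 0ℚ ℚ.< ε → ℕ→ℚ 1 ℚ.≤ ε ℚ.* ℕ→ℚ (ℚ.denominatorℕ ε)
1≤ε*denominator ε 0<ε = go ε (ℚ.positive 0<ε)
  where
  go : ∀ ε → ℚ.Positive ε → ℕ→ℚ 1 ℚ.≤ ε ℚ.* ℕ→ℚ (ℚ.denominatorℕ ε)
  go ε@(ℚ.mkℚ (ℤ.+[1+ p ]) d-1 _) _ = ℚₚ.toℚᵘ-cancel-≤ (begin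
    mkℚᵘ (ℤ.+ 1) 0                                     ≤⟨ *≤* (ℤ.+≤+ (s≤s numerator≥)) ⟩
    mkℚᵘ (ℤ.+[1+ p ]) d-1 ℚᵘ.* mkℚᵘ (ℤ.+ suc d-1) 0    ≃⟨ ℚᵘₚ.*-cong ℚᵘₚ.≃-refl (toℚᵘ-ℕ→ℚ (suc d-1)) ⟨
    ℚ.toℚᵘ ε ℚᵘ.* ℚ.toℚᵘ (ℕ→ℚ (suc d-1))               ≃⟨ ℚₚ.toℚᵘ-homo-* ε (ℕ→ℚ (suc d-1)) ⟨
    ℚ.toℚᵘ (ε ℚ.* ℕ→ℚ (suc d-1))                       ∎)
    where
    open ℚᵘₚ.≤-Reasoning
    numerator≥ : d-1 * 1 + 0 ≤ (d-1 + p * suc d-1) * 1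
    numerator≥ = ≤-trans (≤-reflexive (+-identityʳ (d-1 * 1))) (*-monoˡ-≤ 1 (m≤m+n d-1 (p * suc d-1)))

pow-lower : ∀ x b e → ℕ→ℚ b ℚ.≤ x ℚ.* ℕ→ℚ e → ∀ n → ℕ→ℚ (b ^ n) ℚ.≤ pow x n ℚ.* ℕ→ℚ (e ^ n)
pow-lower x b e b≤xe zero = ℚₚ.≤-reflexive (sym (ℚₚ.*-identityˡ (ℕ→ℚ 1)))
pow-lower x b e b≤xe (suc n) = begin
  ℕ→ℚ (b * b ^ n)                                      ≡⟨ ℕ→ℚ-homo-* b (b ^ n) ⟩
  ℕ→ℚ b ℚ.* ℕ→ℚ (b ^ n)
    ≤⟨ ℚₚ.*-monoʳ-≤-nonNeg (ℕ→ℚ (b ^ n)) {{ℕ→ℚ-nonNeg (b ^ n)}} b≤xe ⟩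
  x ℚ.* ℕ→ℚ e ℚ.* ℕ→ℚ (b ^ n)
    ≤⟨ ℚₚ.*-monoˡ-≤-nonNeg (x ℚ.* ℕ→ℚ e) {{xe≥0}} (pow-lower x b e b≤xe n) ⟩
  x ℚ.* ℕ→ℚ e ℚ.* (pow x n ℚ.* ℕ→ℚ (e ^ n))
    ≡⟨ ℚ-solve 4 (λ x e p f → x ⊗ e ⊗ (p ⊗ f) ⊜ x ⊗ p ⊗ (e ⊗ f)) refl x (ℕ→ℚ e) (pow x n) (ℕ→ℚ (e ^ n)) ⟩
  x ℚ.* pow x n ℚ.* (ℕ→ℚ e ℚ.* ℕ→ℚ (e ^ n))            ≡⟨ cong (x ℚ.* pow x n ℚ.*_) (sym (ℕ→ℚ-homo-* e (e ^ n))) ⟩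
  x ℚ.* pow x n ℚ.* ℕ→ℚ (e * e ^ n)                    ∎
  where
  open ℚₚ.≤-Reasoning
  open ℚ-Solver.+-*-Solver using () renaming (solve to ℚ-solve; _:*_ to _⊗_; _:=_ to _⊜_)
  xe≥0 : ℚ.NonNegative (x ℚ.* ℕ→ℚ e)
  xe≥0 = ℚ.nonNegative (ℚₚ.≤-trans (ℚₚ.nonNegative⁻¹ (ℕ→ℚ b) {{ℕ→ℚ-nonNeg b}}) b≤xe)

scaled-growth : ∀ (A : ℕ → ℕ) D R d .{{_ : NonZero d}} → (∀ n → A n * D ^ n ≤ 2 * n ! * R ^ n) →
  ∀ n → d ≤ n → A n * (D * d) ^ n ≤ n ! * (R * suc d) ^ n
scaled-growth A D R d growth n d≤n = begin
  A n * (D * d) ^ n             ≡⟨ cong (A n *_) (^-distribʳ-* n D d) ⟩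
  A n * (D ^ n * d ^ n)         ≡⟨ sym (*-assoc (A n) (D ^ n) (d ^ n)) ⟩
  A n * D ^ n * d ^ n           ≤⟨ *-monoˡ-≤ (d ^ n) (growth n) ⟩
  2 * n ! * R ^ n * d ^ n
    ≡⟨ solve 3 (λ f r d → con 2 :* f :* r :* d := f :* (r :* (con 2 :* d))) refl (n !) (R ^ n) (d ^ n) ⟩
  n ! * (R ^ n * (2 * d ^ n))   ≤⟨ *-monoʳ-≤ (n !) (*-monoʳ-≤ (R ^ n) (pow-double d n d≤n)) ⟩
  n ! * (R ^ n * suc d ^ n)     ≡⟨ cong (n ! *_) (sym (^-distribʳ-* n R (suc d))) ⟩
  n ! * (R * suc d) ^ n                   ∎
  where open ≤-Reasoning

-- Since R ≤ D, adding ε to r = R / D multiplies it by at least 1 + ε, so the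
-- constant factor 2 is eventually absorbed.
growth-rate : ∀ (A : ℕ → ℕ) (r : ℚ) (D R : ℕ) .{{_ : NonZero D}} → R ≤ D → r ℚ.* ℕ→ℚ D ≡ ℕ→ℚ R →
  (∀ n → A n * D ^ n ≤ 2 * n ! * R ^ n) → ∀ ε → 0ℚ ℚ.< ε →
  Σ ℕ λ N → ∀ n → N ≤ n → ℕ→ℚ (A n) ℚ.≤ ℕ→ℚ (n !) ℚ.* pow (r ℚ.+ ε) n
growth-rate A r D R R≤D rD≡R growth ε 0<ε = d , λ n d≤n → ℚₚ.*-cancelʳ-≤-pos (ℕ→ℚ (den ^ n)) {{ℕ→ℚ-pos (den ^ n) {{m^n≢0 den n}}}} (begin
  ℕ→ℚ (A n) ℚ.* ℕ→ℚ (den ^ n)                    ≡⟨ sym (ℕ→ℚ-homo-* (A n) (den ^ n)) ⟩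
  ℕ→ℚ (A n * den ^ n)                            ≤⟨ ℕ→ℚ-mono-≤ (scaled-growth A D R d growth n d≤n) ⟩
  ℕ→ℚ (n ! * num ^ n)                            ≡⟨ ℕ→ℚ-homo-* (n !) (num ^ n) ⟩
  ℕ→ℚ (n !) ℚ.* ℕ→ℚ (num ^ n)
    ≤⟨ ℚₚ.*-monoˡ-≤-nonNeg (ℕ→ℚ (n !)) {{ℕ→ℚ-nonNeg (n !)}} (pow-lower (r ℚ.+ ε) num den num≤ n) ⟩
  ℕ→ℚ (n !) ℚ.* (pow (r ℚ.+ ε) n ℚ.* ℕ→ℚ (den ^ n)) ≡⟨ sym (ℚₚ.*-assoc (ℕ→ℚ (n !)) _ _) ⟩
  ℕ→ℚ (n !) ℚ.* pow (r ℚ.+ ε) n ℚ.* ℕ→ℚ (den ^ n)   ∎)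
  where
  open ℚₚ.≤-Reasoning
  open ℚ-Solver.+-*-Solver using () renaming (solve to ℚ-solve; _:*_ to _⊗_; _:+_ to _⊕_; _:=_ to _⊜_)
  d = ℚ.denominatorℕ ε
  -- `num` / `den` is r (1 + 1/d), which is at most r + 1/d because r ≤ 1, hence at most r + ε.
  num = R * suc d
  den = D * d
  instance
    den≢0 : NonZero den
    den≢0 = m*n≢0 D d

  num≤ : ℕ→ℚ num ℚ.≤ (r ℚ.+ ε) ℚ.* ℕ→ℚ den
  num≤ = begin
    ℕ→ℚ (R * suc d)                              ≤⟨ ℕ→ℚ-mono-≤ (≤-trans (≤-reflexive (*-suc R d))
                                                      (≤-trans (+-monoˡ-≤ (R * d) R≤D) (≤-reflexive (+-comm D (R * d))))) ⟩
    ℕ→ℚ (R * d + D)                              ≡⟨ ℕ→ℚ-homo-+ (R * d) D ⟩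
    ℕ→ℚ (R * d) ℚ.+ ℕ→ℚ D                        ≡⟨ cong₂ ℚ._+_
      (trans (ℕ→ℚ-homo-* R d) (cong (ℚ._* ℕ→ℚ d) (sym rD≡R))) (sym (ℚₚ.*-identityˡ (ℕ→ℚ D))) ⟩
    r ℚ.* ℕ→ℚ D ℚ.* ℕ→ℚ d ℚ.+ ℕ→ℚ 1 ℚ.* ℕ→ℚ D    ≤⟨ ℚₚ.+-monoʳ-≤ (r ℚ.* ℕ→ℚ D ℚ.* ℕ→ℚ d)
      (ℚₚ.*-monoʳ-≤-nonNeg (ℕ→ℚ D) {{ℕ→ℚ-nonNeg D}} (1≤ε*denominator ε 0<ε)) ⟩
    r ℚ.* ℕ→ℚ D ℚ.* ℕ→ℚ d ℚ.+ ε ℚ.* ℕ→ℚ d ℚ.* ℕ→ℚ D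
      ≡⟨ ℚ-solve 4 (λ r e D d → r ⊗ D ⊗ d ⊕ e ⊗ d ⊗ D ⊜ (r ⊕ e) ⊗ (D ⊗ d)) refl r ε (ℕ→ℚ D) (ℕ→ℚ d) ⟩
    (r ℚ.+ ε) ℚ.* (ℕ→ℚ D ℚ.* ℕ→ℚ d)              ≡⟨ cong ((r ℚ.+ ε) ℚ.*_) (sym (ℕ→ℚ-homo-* D d)) ⟩
    (r ℚ.+ ε) ℚ.* ℕ→ℚ (D * d)                    ∎

-- m² m! is a common denominator of the terms of `bound`. The term 1/m! removes `m * m` from
-- `m * m * suc L`; the solver keeps the inverses as atoms, so their products with `D` are evaluated
-- separately.
bound≡R/D : ∀ m L .{{_ : NonZero m}} → m ! ≡ suc L →
  bound (ℕ→ℚ 64) m ℚ.* ℕ→ℚ (m * m * m !) ≡ ℕ→ℚ (m * m * L + 64)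
bound≡R/D m L m!≡ = begin
  (1ℚ ℚ.- inv (m !) ℚ.+ ℕ→ℚ 64 ℚ.* inv D) ℚ.* ℕ→ℚ D
    ≡⟨ ℚ-solve 4 (λ i c j d → (one ⊕ ⊝ i ⊕ c ⊗ j) ⊗ d ⊜ d ⊕ ⊝ (i ⊗ d) ⊕ c ⊗ (j ⊗ d)) refl
         (inv (m !)) (ℕ→ℚ 64) (inv D) (ℕ→ℚ D) ⟩
  ℕ→ℚ D ℚ.- inv (m !) ℚ.* ℕ→ℚ D ℚ.+ ℕ→ℚ 64 ℚ.* (inv D ℚ.* ℕ→ℚ D)
    ≡⟨ cong₂ (λ x y → x ℚ.- y ℚ.+ ℕ→ℚ 64 ℚ.* (inv D ℚ.* ℕ→ℚ D)) D≡ iD≡ ⟩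
  mm ℚ.* ℕ→ℚ L ℚ.+ mm ℚ.- mm ℚ.+ ℕ→ℚ 64 ℚ.* (inv D ℚ.* ℕ→ℚ D)
    ≡⟨ cong (λ x → mm ℚ.* ℕ→ℚ L ℚ.+ mm ℚ.- mm ℚ.+ ℕ→ℚ 64 ℚ.* x) (inv-* D) ⟩
  mm ℚ.* ℕ→ℚ L ℚ.+ mm ℚ.- mm ℚ.+ ℕ→ℚ 64 ℚ.* 1ℚ
    ≡⟨ ℚ-solve 3 (λ mm l c → mm ⊗ l ⊕ mm ⊕ ⊝ mm ⊕ c ⊗ one ⊜ mm ⊗ l ⊕ c) refl mm (ℕ→ℚ L) (ℕ→ℚ 64) ⟩
  mm ℚ.* ℕ→ℚ L ℚ.+ ℕ→ℚ 64
    ≡⟨ cong (ℚ._+ ℕ→ℚ 64) (sym (ℕ→ℚ-homo-* (m * m) L)) ⟩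
  ℕ→ℚ (m * m * L) ℚ.+ ℕ→ℚ 64
    ≡⟨ sym (ℕ→ℚ-homo-+ (m * m * L) 64) ⟩
  ℕ→ℚ (m * m * L + 64) ∎
  where
  open ≡-Reasoning
  open ℚ-Solver.+-*-Solver using () renaming (solve to ℚ-solve; _:*_ to _⊗_; _:+_ to _⊕_; :-_ to ⊝_; _:=_ to _⊜_; con to κ; Polynomial to Poly)
  one : ∀ {n} → Poly n
  one = κ 1ℚ
  D = m * m * m !
  mm = ℕ→ℚ (m * m)
  instance
    m!≢0 : NonZero (m !)
    m!≢0 = m !≢0
    D≢0 : NonZero D
    D≢0 = m*n≢0 (m * m) (m !) {{m*n≢0 m m}}
  D≡ : ℕ→ℚ D ≡ mm ℚ.* ℕ→ℚ L ℚ.+ mm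
  D≡ = trans (cong ℕ→ℚ (trans (cong (m * m *_) m!≡) (trans (*-suc (m * m) L) (+-comm (m * m) (m * m * L)))))
    (trans (ℕ→ℚ-homo-+ (m * m * L) (m * m)) (cong (ℚ._+ mm) (ℕ→ℚ-homo-* (m * m) L)))
  iD≡ : inv (m !) ℚ.* ℕ→ℚ D ≡ mm
  iD≡ = trans (cong (inv (m !) ℚ.*_) (ℕ→ℚ-homo-* (m * m) (m !)))
    (trans (ℚ-solve 3 (λ i a b → i ⊗ (a ⊗ b) ⊜ a ⊗ (i ⊗ b)) refl (inv (m !)) mm (ℕ→ℚ (m !)))
      (trans (cong (mm ℚ.*_) (inv-* (m !))) (ℚₚ.*-identityʳ mm)))

theorem1 : Σ ℚ (λ C → (0ℚ ℚ.< C) × Σ ℕ (λ m₀ →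
    ∀ (m : ℕ) → m₀ ≤ m →
    ∀ (σ : List ℕ) → σ ∈ S m → σ ≢ increasing m → σ ≢ decreasing m →
    ρ≤ σ (bound C m)))
-- The threshold 8 makes 4 / m at most 1 / 2, and it also gives 64 ≤ m², that is `R≤D`: the claimed
-- rate does not exceed 1.
theorem1 = ℕ→ℚ 64 , ℚₚ.positive⁻¹ (ℕ→ℚ 64) , 8 , λ m 8≤m σ σ∈ ≢inc ≢dec →
  let L = pred (m !)
      m!≡ : m ! ≡ suc L
      m!≡ = sym (suc-pred (m !) {{m !≢0}})
      m≢0 : NonZero m
      m≢0 = >-nonZero (≤-trans (s≤s z≤n) 8≤m)
      D = m * m * m !
      R≤D : m * m * L + 64 ≤ D
      R≤D = begin
        m * m * L + 64       ≤⟨ +-monoʳ-≤ (m * m * L) (*-mono-≤ 8≤m 8≤m) ⟩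
        m * m * L + m * m    ≡⟨ +-comm (m * m * L) (m * m) ⟩
        m * m + m * m * L    ≡⟨ sym (*-suc (m * m) L) ⟩
        m * m * suc L        ≡⟨ cong (m * m *_) (sym m!≡) ⟩
        D                    ∎
  in growth-rate (λ n → α n σ) (bound (ℕ→ℚ 64) m) D (m * m * L + 64)
       {{m*n≢0 (m * m) (m !) {{m*n≢0 m m {{m≢0}} {{m≢0}}}} {{m !≢0}}}} R≤D (bound≡R/D m L {{m≢0}} m!≡)
       (Growth.growth (λ n → α n σ) (λ n → count-≤! (avoids? σ) n) m L 8≤m m!≡
         (Recurrence.avoiders-recurrence σ∈ (≤-trans (s≤s (s≤s z≤n)) 8≤m) m!≡ ≢inc ≢dec))
  where open ≤-Reasoning
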